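{- Let $R$ be any totally ordered semi-ring. There is an absolute constant $\epsilon>0$ such that for all sufficiently large $n$, if the Hamiltonian Cycle polynomial $HC_n$ is a monotone affine projection of the permanent $\mathrm{perm}_m$ over $R$, then $m\geq 2^{\epsilon n}$. In particular, the family $(HC_n)$ is not a monotone affine p-projection of the family $(\mathrm{perm}_m)$.
   Context: A (commutative) totally ordered semi-ring is a totally ordered set $(R,\leq)$ with operations $\times,+$ and elements $1\neq 0$ such that $(R,\times,1)$, $(R,+,0)$ are commutative monoids, $\times$ distributes over $+$, $0\times a=0$, $a+c\leq b+c$ whenever $a\leq b$, and $ac\leq bc$ whenever $a\leq b$ and $0\leq c$. Examples: $(\mathbb{R},\times,+)$, the tropical semi-ring $(\mathbb{R},+,\min)$, the Boolean semi-ring $(\{0,1\},\wedge,\vee)$. An element $c$ is non-negative if $0\leq c$. Polynomials are formal polynomials over $R$. The permanent is $\mathrm{perm}_m(Y)=\sum_{\pi\in S_m} y_{1,\pi(1)}\cdots y_{m,\pi(m)}$ in the $m^2$ variables $y_{ij}$. The Hamiltonian Cycle polynomial is $HC_n(X)=\sum_{\sigma} x_{1,\sigma(1)}\cdots x_{n,\sigma(n)}$ in variables $x_{ij}$ ($i,j\in[n]$), the sum over all permutations $\sigma\in S_n$ that are $n$-cycles. A polynomial $f(x_1,\dots,x_n)$ is a monotone affine projection of $g(y_1,\dots,y_m)$ if $f$ is obtained from $g$ by substituting for each $y_i$ an affine linear function $a_0+a_1x_1+\dots+a_nx_n$ with all $a_k\in R$ non-negative. A family $(f_n)$ is a monotone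 affine p-projection of $(g_m)$ if there is a polynomially bounded function $p$ with $f_n$ a monotone affine projection of $g_{p(n)}$ for all sufficiently large $n$. -}

module Defs where

open import Level using (Level; _⊔_) renaming (suc to lsuc)
open import Data.Nat using (ℕ; zero; suc; _≡ᵇ_; _^_) renaming (_+_ to _+ℕ_; _*_ to _*ℕ_; _≤_ to _≤ℕ_)
open import Data.Fin using (Fin; zero; suc; _≟_)
open import Data.Bool using (Bool; true; false; if_then_else_; _∧_; _∨_; not)
open import Data.List using (List; []; _∷_; map; concatMap; foldr; allFin; upTo; filterᵇ)
open import Data.Bool.ListAction using (all; any)
open import Data.Product using (Σ; _×_; _,_; ∃)
open import Relation.Nullary using (¬_; does)
open import Relation.Binary.Core using (Rel)
open import Relation.Binary.Structures using (IsTotalOrder)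
open import Algebra.Bundles using (CommutativeSemiring)

record TotallyOrderedSemiring (c ℓ₁ ℓ₂ : Level) : Set (lsuc (c ⊔ ℓ₁ ⊔ ℓ₂)) where
  field
    commutativeSemiring : CommutativeSemiring c ℓ₁
  open CommutativeSemiring commutativeSemiring public
  infix 4 _≤R_
  field
    _≤R_         : Rel Carrier ℓ₂
    isTotalOrder : IsTotalOrder _≈_ _≤R_
    1≉0          : ¬ (1# ≈ 0#)
    +-mono       : ∀ {a b} z → a ≤R b → (a + z) ≤R (b + z)
    *-mono       : ∀ {a b z} → a ≤R b → 0# ≤R z → (a * z) ≤R (b * z)

allFuns : (k m : ℕ) → List (Fin k → Fin m)
allFuns zero    m = (λ ()) ∷ []
allFuns (suc k) m = concatMap (λ i → map (λ f → cons i f) (allFuns k m)) (allFin m)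
  where
  cons : Fin m → (Fin k → Fin m) → Fin (suc k) → Fin m
  cons i f zero    = i
  cons i f (suc x) = f x

_==_ : ∀ {n} → Fin n → Fin n → Bool
i == j = does (i ≟ j)

isInjective : ∀ {n} → (Fin n → Fin n) → Bool
isInjective {n} f = all (λ i → all (λ j → not (f i == f j) ∨ (i == j)) (allFin n)) (allFin n)

iter : ∀ {n} → (Fin n → Fin n) → ℕ → Fin n → Fin n
iter f zero    x = x
iter f (suc k) x = f (iter f k x)

isSingleOrbit : ∀ {n} → (Fin n → Fin n) → Bool
isSingleOrbit {n} f =
  all (λ i → all (λ j → any (λ k → iter f k i == j) (upTo n)) (allFin n)) (allFin n)

permutations : (n : ℕ) → List (Fin n → Fin n)
permutations n = filterᵇ isInjective (allFuns n n)

nCycles : (n : ℕ) → List (Fin n → Fin n)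
nCycles n = filterᵇ (λ f → isInjective f ∧ isSingleOrbit f) (allFuns n n)

-- Formal polynomials over R in variables x_{ij}, i,j ∈ Fin k.
-- A monomial is an exponent matrix; a polynomial is a finite list of
-- terms (coefficient , monomial); two polynomials are equal as formal
-- polynomials iff all their coefficients agree (coeff below).

Mono : ℕ → Set
Mono k = Fin k → Fin k → ℕ

monoEq : ∀ {k} → Mono k → Mono k → Bool
monoEq {k} μ ν = all (λ i → all (λ j → μ i j ≡ᵇ ν i j) (allFin k)) (allFin k)

zeroMono : ∀ {k} → Mono k
zeroMono i j = 0

_⊕_ : ∀ {k} → Mono k → Mono k → Mono k
(μ ⊕ ν) i j = μ i j +ℕ ν i j

varMono : ∀ {k} → Fin k → Fin k → Mono k
varMono a b i j = if (a == i) ∧ (b == j) then 1 else 0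

permMono : ∀ {k} → (Fin k → Fin k) → Mono k
permMono σ i j = if σ i == j then 1 else 0

module Polynomials {c ℓ₁ ℓ₂} (R : TotallyOrderedSemiring c ℓ₁ ℓ₂) where
  open TotallyOrderedSemiring R

  Poly : ℕ → Set c
  Poly k = List (Carrier × Mono k)

  coeff : ∀ {k} → Poly k → Mono k → Carrier
  coeff []            μ = 0#
  coeff ((a , ν) ∷ P) μ = (if monoEq ν μ then a else 0#) + coeff P μ

  _≈P_ : ∀ {k} → Poly k → Poly k → Set ℓ₁
  P ≈P Q = ∀ μ → coeff P μ ≈ coeff Q μ

  onePoly : ∀ {k} → Poly k
  onePoly = (1# , zeroMono) ∷ []

  _⊗_ : ∀ {k} → Poly k → Poly k → Poly k
  P ⊗ Q = concatMap (λ { (a , μ) → map (λ { (b , ν) → (a * b , μ ⊕ ν) }) Q }) P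

  _^P_ : ∀ {k} → Poly k → ℕ → Poly k
  P ^P zero  = onePoly
  P ^P suc e = P ⊗ (P ^P e)

  perm : (m : ℕ) → Poly m
  perm m = map (λ σ → (1# , permMono σ)) (permutations m)

  HC : (n : ℕ) → Poly n
  HC n = map (λ σ → (1# , permMono σ)) (nCycles n)

  affine : ∀ {n} → Carrier → (Fin n → Fin n → Carrier) → Poly n
  affine {n} a₀ a =
    (a₀ , zeroMono) ∷ concatMap (λ k → map (λ l → (a k l , varMono k l)) (allFin n)) (allFin n)

  substitute : ∀ {m n} → (Fin m → Fin m → Poly n) → Poly m → Poly n
  substitute {m} {n} L = concatMap substTerm
    where
    substTerm : Carrier × Mono m → Poly n
    substTerm (a , μ) =
      ((a , zeroMono) ∷ []) ⊗
      foldr _⊗_ onePoly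
        (concatMap (λ i → map (λ j → L i j ^P μ i j) (allFin m)) (allFin m))

  IsMonotoneAffineProjection : ∀ {n m} → Poly n → Poly m → Set (c ⊔ ℓ₁ ⊔ ℓ₂)
  IsMonotoneAffineProjection {n} {m} f g =
    Σ (Fin m → Fin m → Carrier) λ a₀ →
    Σ (Fin m → Fin m → Fin n → Fin n → Carrier) λ a →
      (∀ i j → 0# ≤R a₀ i j) ×
      (∀ i j k l → 0# ≤R a i j k l) ×
      (substitute (λ i j → affine (a₀ i j) (a i j)) g ≈P f)

PolynomiallyBounded : (ℕ → ℕ) → Set
PolynomiallyBounded p = ∃ λ C → ∃ λ d → ∀ n → p n ≤ℕ C *ℕ n ^ d +ℕ C

HCIsPProjectionOfPerm : ∀ {c ℓ₁ ℓ₂} → TotallyOrderedSemiring c ℓ₁ ℓ₂ → Set (c ⊔ ℓ₁ ⊔ ℓ₂)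
HCIsPProjectionOfPerm R =
  Σ (ℕ → ℕ) λ p → PolynomiallyBounded p ×
    (∃ λ N → ∀ n → N ≤ℕ n → IsMonotoneAffineProjection (HC n) (perm (p n)))
  where open Polynomials R

{-# OPTIONS --safe #-}
module Submission where

-- Because the order is total, the nilpotents form a prime ideal of the nonnegative cone. Hence only the support of
-- a projection matters: it is a bipartite graph on [m] + [m] whose edges are labelled by 1 or by variables, such
-- that the label product of every perfect matching is an n-cycle monomial and every n-cycle arises in this way.
--
-- Keep only the variables of a digraph made of N = 2h gadgets which has a single "backward"
-- Hamiltonian cycle, and one "forward" Hamiltonian cycle for every ordering of the gadgets. The jumps between
-- gadgets used by a Hamiltonian cycle form a permutation matrix if it is forward, and there are none if it is
-- backward. Relative to a matching of the backward cycle, matchings become disjoint cycles of a digraph on [m],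
-- and loop erasure shows that in every closed walk all row and column sums of its jump matrix coincide.
--
-- Cut the closed walk of a forward cycle in two parts at the vertex where h jumps remain. Two forward cycles with
-- the same end points of the parts can be recombined, so their second parts have the same set I of jump sources
-- and the same set J of jump targets. An ordering maps I to J for at most h! h! of the (2h)! orderings, so there
-- are at least (2h)! / (h! h!) >= 2^h pairs of end points, while there are only m^2.
open import Defs
import Level
open import Level using (Level)
open import Data.Bool using (Bool; true; false; T; not; _∧_; _∨_; if_then_else_)
open import Data.Bool.ListAction using (all)
open import Data.Bool.Properties using (T-∧)
open import Data.Empty using (⊥; ⊥-elim)
open import Data.Fin using (Fin; zero; suc; _≟_; toℕ; fromℕ; inject₁; punchOut; _↑ˡ_; _↑ʳ_; combine; remQuot; splitAt)
open import Data.Fin.Induction using (<-weakInduction)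
open import Data.Fin.Permutation.Components using (transpose; transpose-inverse)
open import Data.Fin.Properties
  using (toℕ-injective; toℕ-fromℕ; toℕ-inject₁; toℕ<n; any?; pigeonhole; injective⇒≤; punchOut-injective;
         splitAt-↑ˡ; splitAt-↑ʳ; splitAt⁻¹-↑ˡ; splitAt⁻¹-↑ʳ; remQuot-combine; combine-remQuot; combine-injective)
  renaming (suc-injective to Fin-suc-injective)
open import Data.List
  using (List; []; _∷_; _++_; map; concat; concatMap; foldr; length; lookup; allFin; tabulate; upTo)
open import Data.List.Membership.Propositional using (_∈_; find; lose)
open import Data.List.Membership.Propositional.Properties
  using (∈-++⁺ˡ; ∈-++⁺ʳ; ∈-map⁺; ∈-map⁻; ∈-concatMap⁺; ∈-concatMap⁻; ∈-filter⁺; ∈-filter⁻; ∈-tabulate⁺; ∈-allFin; ∈-upTo⁺; ∈-upTo⁻)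
open import Data.List.Properties
  using (length-map; length-++; length-tabulate; map-cong; map-tabulate; tabulate-lookup; foldr-++; ++-identityʳ)
open import Data.List.Relation.Unary.All using (All; []; _∷_)
import Data.List.Relation.Unary.All as All
open import Data.List.Relation.Unary.All.Properties using (all⁺; all⁻; tabulate⁺; tabulate⁻)
open import Data.List.Relation.Unary.AllPairs using (_∷_)
open import Data.List.Relation.Unary.Any using (here; there; index)
open import Data.List.Relation.Unary.Any.Properties using (any⁺; any⁻; lookup-index)
open import Data.List.Relation.Unary.Unique.Propositional using (Unique)
import Data.List.Relation.Unary.Unique.Propositional.Properties as Uniqueₚ
open import Data.Maybe using (Maybe; just; nothing)
open import Data.Nat using (ℕ; zero; suc)
import Data.Nat as ℕ
import Data.Nat.Properties as ℕₚ
open import Data.Nat.Tactic.RingSolver using (solve-∀)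
open import Data.Product using (∃; _×_; _,_; proj₁; proj₂)
open import Data.Sum using (_⊎_; inj₁; inj₂)
open import Data.Unit using (⊤; tt)
open import Data.Vec using (Vec; []; _∷_)
import Data.Vec as Vec
import Data.Vec.Membership.Propositional as Vecₘ
open import Data.Vec.Membership.Propositional.Properties using (∈-allFin⁺)
import Data.Vec.Relation.Unary.Any as VecAny
open import Function using (_∘_; id)
open import Function.Bundles using (Equivalence)
open import Function.Definitions using (Injective)
open import Relation.Binary.PropositionalEquality
  using (_≡_; _≢_; refl; sym; trans; cong; cong₂; subst; subst₂; module ≡-Reasoning)
open import Relation.Binary.Structures using (IsTotalOrder)
open import Relation.Nullary using (¬_; yes; no; does; contradiction; ¬¬-excluded-middle)
open import Relation.Nullary.Decidable using (T?; dec-true; dec-false; decidable-stable)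
open import Algebra.Properties.Semiring.Sum ℕₚ.+-*-semiring
  using (sum; sum-cong-≗; ∑-distrib-+; ∑-comm; *-distribʳ-sum; sum-replicate-zero)
import Algebra.Properties.CommutativeSemiring.Exp as CommutativeExp
import Algebra.Properties.Semiring.Exp as Exp
import Algebra.Properties.Semiring.Mult as Mult
import Relation.Binary.Reasoning.Setoid as SetoidReasoning

-- Nonnegative nonzero elements may have product zero, so supports made of nonzero coefficients
-- would not be multiplicative. "Not nilpotent" replaces "nonzero": the order makes it
-- multiplicative, and a sum that is not nilpotent has a term that is not. This cannot be decided,
-- so matchings are obtained only under double negation; the goal `2 ^ h ≤ m * m` is decidable,
-- which removes it at the end. A recombined closed walk may repeat vertices, so it is no matching
-- and has no Hamiltonian cycle attached to it. What survives is a linear identity: each row or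
-- column sum equals one fixed column sum. It is checked on permutations, where it is a property of
-- a single Hamiltonian cycle, and loop erasure carries it over to walks. To complete a simple cycle
-- to a permutation, the other vertices need loops of weight zero; this is why a Hamiltonian cycle
-- without jumps has to exist.

module Combinatorics where

  open import Data.Nat using (_≤_; _<_; _+_; _*_; _∸_; _^_; _!; z≤n; s≤s)
  open import Data.Nat.Properties hiding (_≟_)

  -- Walks and loop erasure

  sum-zero : ∀ {n} {g : Fin n → ℕ} → (∀ i → g i ≡ 0) → sum g ≡ 0
  sum-zero {n} g≡0 = trans (sum-cong-≗ g≡0) (sum-replicate-zero n)

  -- The old value is added on the left, which replaces a subtraction.
  sum-update : ∀ {n} {L : Set} (f : L → ℕ) (h : Fin n → L) a c →
    sum (λ i → f (if does (i ≟ a) then c else h i)) + f (h a) ≡ f c + sum (f ∘ h)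
  sum-update f h zero c = lemma (f c) _ _
    where
    lemma : ∀ x y z → (x + y) + z ≡ x + (z + y)
    lemma = solve-∀
  sum-update f h (suc a) c =
    trans (+-assoc (f (h zero)) _ _)
      (trans (cong (f (h zero) +_) (sum-update f (h ∘ suc) a c)) (lemma (f (h zero)) (f c) _))
    where
    lemma : ∀ x y z → x + (y + z) ≡ y + (x + z)
    lemma = solve-∀

  sum-pick : ∀ {n} (g : Fin n → ℕ) a → (∀ i → i ≢ a → g i ≡ 0) → sum g ≡ g a
  sum-pick g zero z = trans (cong (g zero +_) (sum-zero λ i → z (suc i) λ ())) (+-identityʳ _)
  sum-pick g (suc a) z =
    trans (cong (_+ sum (g ∘ suc)) (z zero λ ())) (sum-pick (g ∘ suc) a λ i i≢a → z (suc i) (i≢a ∘ Fin-suc-injective))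

  ≤-sum : ∀ {n} (g : Fin n → ℕ) a → g a ≤ sum g
  ≤-sum g zero    = m≤m+n _ _
  ≤-sum g (suc a) = ≤-trans (≤-sum (g ∘ suc) a) (m≤n+m _ _)

  +-≤-sum : ∀ {n} (g : Fin n → ℕ) {a b} → a ≢ b → g a + g b ≤ sum g
  +-≤-sum g {zero}  {zero}  a≢b = contradiction refl a≢b
  +-≤-sum g {zero}  {suc b} a≢b = +-monoʳ-≤ (g zero) (≤-sum (g ∘ suc) b)
  +-≤-sum g {suc a} {zero}  a≢b =
    subst (_≤ sum g) (+-comm (g zero) (g (suc a))) (+-monoʳ-≤ (g zero) (≤-sum (g ∘ suc) a))
  +-≤-sum g {suc a} {suc b} a≢b = ≤-trans (+-≤-sum (g ∘ suc) (a≢b ∘ cong suc)) (m≤n+m _ _)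

  sum-positive : ∀ {n} (g : Fin n → ℕ) → 0 < sum g → ∃ λ i → 0 < g i
  sum-positive {suc n} g 0<s with g zero in eq
  ... | suc k = zero , subst (0 <_) (sym eq) (s≤s z≤n)
  ... | zero  = let i , 0<gi = sum-positive (g ∘ suc) 0<s in suc i , 0<gi

  transpose-fixes : ∀ {n} (a b i : Fin n) → i ≢ a → i ≢ b → transpose a b i ≡ i
  transpose-fixes a b i i≢a i≢b rewrite dec-false (i ≟ a) i≢a | dec-false (i ≟ b) i≢b = refl

  transpose-left : ∀ {n} (a b : Fin n) → transpose a b a ≡ b
  transpose-left a b rewrite dec-true (a ≟ a) refl = refl

  transpose-right : ∀ {n} (a b : Fin n) → transpose a b b ≡ a
  transpose-right a b with b ≟ a
  ... | yes refl = refl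
  ... | no  b≢a rewrite dec-true (b ≟ b) refl = refl

  transpose-injective : ∀ {n} (a b : Fin n) → Injective _≡_ _≡_ (transpose a b)
  transpose-injective a b eq =
    trans (sym (transpose-inverse b a)) (trans (cong (transpose b a) eq) (transpose-inverse b a))

  iter-shift : ∀ {n} (f : Fin n → Fin n) k x → iter f k (f x) ≡ iter f (suc k) x
  iter-shift f zero    x = refl
  iter-shift f (suc k) x = cong f (iter-shift f k x)

  module Walks {m : ℕ} {ℓ : Level} {Lab : Set} (E : Fin m → Fin m → Lab → Set ℓ) where

    data Walk : Fin m → Fin m → Set ℓ where
      nil  : ∀ {a} → Walk a a
      step : ∀ {a a′ b} (c : Lab) → E a a′ c → Walk a′ b → Walk a b

    weight : ∀ {a b} → (Lab → ℕ) → Walk a b → ℕ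
    weight f nil          = 0
    weight f (step c _ w) = f c + weight f w

    _⁀_ : ∀ {a b c} → Walk a b → Walk b c → Walk a c
    nil        ⁀ w′ = w′
    step c e w ⁀ w′ = step c e (w ⁀ w′)

    weight-⁀ : ∀ {a b c} f (w : Walk a b) (w′ : Walk b c) → weight f (w ⁀ w′) ≡ weight f w + weight f w′
    weight-⁀ f nil          w′ = refl
    weight-⁀ f (step c _ w) w′ = trans (cong (f c +_) (weight-⁀ f w w′)) (sym (+-assoc (f c) _ _))

    data AllSteps {p} (P : Lab → Set p) : ∀ {a b} → Walk a b → Set (ℓ Level.⊔ p) where
      nil  : ∀ {a} → AllSteps P (nil {a})
      step : ∀ {a a′ b c} {e : E a a′ c} {w : Walk a′ b} → P c → AllSteps P w → AllSteps P (step c e w)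

    weight-cong : ∀ {a b f g} {w : Walk a b} → AllSteps (λ c → f c ≡ g c) w → weight f w ≡ weight g w
    weight-cong nil         = refl
    weight-cong (step p ps) = cong₂ _+_ p (weight-cong ps)

    weight-sum : ∀ {k a b} (f : Fin k → Lab → ℕ) (w : Walk a b) →
      weight (λ c → sum (λ i → f i c)) w ≡ sum (λ i → weight (f i) w)
    weight-sum {k} f nil  = sym (sum-zero {k} λ _ → refl)
    weight-sum f (step c _ w) =
      trans (cong (sum (λ i → f i c) +_) (weight-sum f w)) (sym (∑-distrib-+ (λ i → f i c) (λ i → weight (f i) w)))

    AllSteps-map : ∀ {p q} {P : Lab → Set p} {Q : Lab → Set q} → (∀ {c} → P c → Q c) →
      ∀ {a b} {w : Walk a b} → AllSteps P w → AllSteps Q w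
    AllSteps-map f nil         = nil
    AllSteps-map f (step p ps) = step (f p) (AllSteps-map f ps)

    -- A discrete intermediate value argument: dropping one step lowers the remaining weight by at
    -- most 1, so the value `h` is not jumped over.
    split-suffix : ∀ {a b p} {P : Lab → Set p} (f : Lab → ℕ) (h : ℕ) (w : Walk a b) →
      AllSteps P w → AllSteps (λ c → f c ≤ 1) w → h ≤ weight f w →
      ∃ λ v → ∃ λ (w₁ : Walk a v) → ∃ λ (w₂ : Walk v b) →
        AllSteps P w₂ × w ≡ w₁ ⁀ w₂ × weight f w₂ ≡ h
    split-suffix f h nil _ _ h≤ = _ , nil , nil , nil , refl , sym (n≤0⇒n≡0 h≤)
    split-suffix f h (step c e w) (step p ps) (step fc≤1 fs≤1) h≤ with h ≤? weight f w
    ... | yes h≤w = let v , w₁ , w₂ , ps₂ , eq , fw₂ = split-suffix f h w ps fs≤1 h≤w in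
                    v , step c e w₁ , w₂ , ps₂ , cong (step c e) eq , fw₂
    ... | no  h≰w = _ , nil , step c e w , step p ps , refl ,
                    ≤-antisym (≤-trans (+-monoˡ-≤ (weight f w) fc≤1) (≰⇒> h≰w)) h≤

    orbit-walk : ∀ {p} {P : Lab → Set p} (f : Fin m → Fin m) (lab : Fin m → Lab) →
      (∀ i → E i (f i) (lab i)) → ∀ u → (∀ i → i ≢ u → P (lab i)) →
      ∀ k x → iter f k x ≡ u → ∃ λ (w : Walk x u) → AllSteps P w
    orbit-walk f lab e u p zero x refl = nil , nil
    orbit-walk f lab e u p (suc k) x eq with x ≟ u
    ... | yes refl = nil , nil
    ... | no  x≢u  = let w , ps = orbit-walk f lab e u p k (f x) (trans (iter-shift f k x) eq) in
                     step (lab x) (e x) w , step (p x x≢u) ps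

  -- The loops labelled by `c₀` complete a single cycle to a permutation at no cost in `f` or `s`,
  -- so that `balanced`, which speaks only of permutations, can be applied to that cycle.
  module LoopErasure {m : ℕ} {ℓ : Level} {Lab : Set} (E : Fin m → Fin m → Lab → Set ℓ)
    (c₀ : Fin m → Lab) (e₀ : ∀ i → E i i (c₀ i))
    (f s : Lab → ℕ) (f₀ : ∀ i → f (c₀ i) ≡ 0) (s₀ : ∀ i → s (c₀ i) ≡ 0)
    (balanced : ∀ (π : Fin m → Fin m) (lab : Fin m → Lab) → Injective _≡_ _≡_ π →
      (∀ i → E i (π i) (lab i)) → sum (f ∘ lab) ≡ sum (s ∘ lab)) where

    open Walks E

    Avoids : ∀ {a b} → Fin m → Walk a b → Set
    Avoids x (nil {a})          = x ≢ a
    Avoids x (step {a} _ _ w)   = x ≢ a × Avoids x w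

    Simple : ∀ {a b} → Walk a b → Set
    Simple nil              = ⊤
    Simple (step {a} _ _ w) = Avoids a w × Simple w

    avoids-start : ∀ {a b x} (w : Walk a b) → Avoids x w → x ≢ a
    avoids-start nil          x≢   = x≢
    avoids-start (step _ _ _) (x≢ , _) = x≢

    avoids-end : ∀ {a b x} (w : Walk a b) → Avoids x w → x ≢ b
    avoids-end nil          x≢      = x≢
    avoids-end (step _ _ w) (_ , av) = avoids-end w av

    -- The cycle that closes up a simple walk, written as a product of transpositions so that injectivity is clear.
    rotation : ∀ {a b} → Walk a b → Fin m → Fin m
    rotation nil                   = id
    rotation (step {a} {a′} _ _ w) = transpose a a′ ∘ rotation w

    -- `c` is the label of the edge that closes the walk, from its end back to its start.
    relabel : ∀ {a b} → Walk a b → Lab → Fin m → Lab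
    relabel (nil {a})        c i = if does (i ≟ a) then c else c₀ i
    relabel (step {a} c′ _ w) c i = if does (i ≟ a) then c′ else relabel w c i

    rotation-injective : ∀ {a b} (w : Walk a b) → Injective _≡_ _≡_ (rotation w)
    rotation-injective nil                   eq = eq
    rotation-injective (step {a} {a′} _ _ w) eq = rotation-injective w (transpose-injective a a′ eq)

    rotation-end : ∀ {a b} (w : Walk a b) → rotation w b ≡ a
    rotation-end nil                   = refl
    rotation-end (step {a} {a′} _ _ w) = trans (cong (transpose a a′) (rotation-end w)) (transpose-right a a′)

    rotation-fixes : ∀ {a b x} (w : Walk a b) → Avoids x w → rotation w x ≡ x
    rotation-fixes nil _ = refl
    rotation-fixes {x = x} (step {a} {a′} _ _ w) (x≢a , av) =
      trans (cong (transpose a a′) (rotation-fixes w av)) (transpose-fixes a a′ x x≢a (avoids-start w av))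

    relabel-avoids : ∀ {a b x} (w : Walk a b) c → Avoids x w → relabel w c x ≡ c₀ x
    relabel-avoids {x = x} (nil {a}) c x≢a rewrite dec-false (x ≟ a) x≢a = refl
    relabel-avoids {x = x} (step {a} _ _ w) c (x≢a , av) rewrite dec-false (x ≟ a) x≢a = relabel-avoids w c av

    relabel-end : ∀ {a b} (w : Walk a b) c → Simple w → relabel w c b ≡ c
    relabel-end (nil {a}) c _ rewrite dec-true (a ≟ a) refl = refl
    relabel-end {b = b} (step {a} _ _ w) c (av , sw)
      rewrite dec-false (b ≟ a) (avoids-end w av ∘ sym) = relabel-end w c sw

    -- In the inductive step, for `i` other than `a` and `b`, the outer transposition does nothing:
    -- the values `a` and `a′` of `rotation w` are already taken, at `a`, which `w` avoids, and at
    -- `b`.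
    rotation-edge : ∀ {a b} (w : Walk a b) c → Simple w → ∀ i → i ≢ b → E i (rotation w i) (relabel w c i)
    rotation-edge (nil {a}) c _ i i≢a rewrite dec-false (i ≟ a) i≢a = e₀ i
    rotation-edge {b = b} (step {a} {a′} c′ e w) c (av , sw) i i≢b with i ≟ a
    ... | yes refl rewrite rotation-fixes w av | transpose-left a a′ = e
    ... | no  i≢a = subst (λ j → E i j (relabel w c i)) (sym (transpose-fixes a a′ _ ≢a ≢a′))
                      (rotation-edge w c sw i i≢b)
      where
      ≢a : rotation w i ≢ a
      ≢a eq = i≢a (rotation-injective w (trans eq (sym (rotation-fixes w av))))
      ≢a′ : rotation w i ≢ a′
      ≢a′ eq = i≢b (rotation-injective w (trans eq (sym (rotation-end w))))

    sum-relabel : ∀ {a b} (g : Lab → ℕ) → (∀ i → g (c₀ i) ≡ 0) → (w : Walk a b) → ∀ c → Simple w →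
      sum (g ∘ relabel w c) ≡ weight g w + g c
    sum-relabel g g₀ (nil {a}) c _ = begin
      total                         ≡⟨ +-identityʳ total ⟨
      total + 0                      ≡⟨ cong (total +_) (g₀ a) ⟨
      total + g (c₀ a)               ≡⟨ sum-update g c₀ a c ⟩
      g c + sum (g ∘ c₀)         ≡⟨ cong (g c +_) (sum-zero g₀) ⟩
      g c + 0                    ≡⟨ +-identityʳ (g c) ⟩
      g c                        ∎
      where open ≡-Reasoning
            total = sum (g ∘ relabel (nil {a}) c)
    sum-relabel g g₀ (step {a} c′ e w) c (av , sw) = begin
      total                                ≡⟨ +-identityʳ total ⟨
      total + 0                             ≡⟨ cong (total +_) (trans (cong g (relabel-avoids w c av)) (g₀ a)) ⟨
      total + g (relabel w c a)             ≡⟨ sum-update g (relabel w c) a c′ ⟩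
      g c′ + sum (g ∘ relabel w c)      ≡⟨ cong (g c′ +_) (sum-relabel g g₀ w c sw) ⟩
      g c′ + (weight g w + g c)         ≡⟨ +-assoc (g c′) _ _ ⟨
      g c′ + weight g w + g c           ∎
      where open ≡-Reasoning
            total = sum (g ∘ relabel (step c′ e w) c)

    simple-cycle-balanced : ∀ {a b c} (w : Walk a b) → Simple w → E b a c →
      weight f w + f c ≡ weight s w + s c
    simple-cycle-balanced {a} {b} {c} w sw e =
      trans (sym (sum-relabel f f₀ w c sw))
        (trans (balanced (rotation w) (relabel w c) (rotation-injective w) edge) (sum-relabel s s₀ w c sw))
      where
      edge : ∀ i → E i (rotation w i) (relabel w c i)
      edge i with i ≟ b
      ... | no  i≢b  = rotation-edge w c sw i i≢b
      ... | yes refl rewrite rotation-end w | relabel-end w c sw = e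

    split-at : ∀ {x b} a (w : Walk x b) → Simple w →
      Avoids a w ⊎ (∃ λ (w₁ : Walk x a) → ∃ λ (w₂ : Walk a b) →
        Simple w₁ × Simple w₂ × w ≡ w₁ ⁀ w₂ × (∀ y → Avoids y w → Avoids y w₁))
    split-at {x} a w sw with a ≟ x
    ... | yes refl = inj₂ (nil , w , tt , sw , refl , λ y → avoids-start w)
    split-at a nil sw | no a≢x = inj₁ a≢x
    split-at a (step c e w) (av , sw) | no a≢x with split-at a w sw
    ... | inj₁ av′ = inj₁ (a≢x , av′)
    ... | inj₂ (w₁ , w₂ , sw₁ , sw₂ , eq , sub) =
          inj₂ (step c e w₁ , w₂ , (sub _ av , sw₁) , sw₂ , cong (step c e) eq , λ y (y≢ , avy) → y≢ , sub y avy)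

    -- The equation says that `f` minus `s` is unchanged, because only balanced simple cycles are
    -- removed; it is arranged so that no subtraction occurs.
    loop-erase : ∀ {a b} (w : Walk a b) →
      ∃ λ (w′ : Walk a b) → Simple w′ × weight f w + weight s w′ ≡ weight f w′ + weight s w
    loop-erase nil = nil , tt , refl
    loop-erase (step {a} c e w) with loop-erase w
    ... | w′ , sw′ , eq with split-at a w′ sw′
    ...   | inj₁ av = step c e w′ , (av , sw′) ,
            trans (lemma₁ (f c) (weight f w) (s c) (weight s w′))
              (trans (cong (λ z → f c + s c + z) eq) (lemma₂ (f c) (s c) (weight f w′) (weight s w)))
      where
      lemma₁ : ∀ x y z t → (x + y) + (z + t) ≡ x + z + (y + t)
      lemma₁ = solve-∀
      lemma₂ : ∀ x y z t → x + y + (z + t) ≡ (x + z) + (y + t)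
      lemma₂ = solve-∀
    -- The new step closes `w₁` to a simple cycle, which is dropped. Adding `weight s w₁` to both
    -- sides lets the balance of this cycle be inserted.
    ...   | inj₂ (w₁ , w₂ , sw₁ , sw₂ , refl , _) = w₂ , sw₂ , +-cancelˡ-≡ (weight s w₁) _ _ (begin
            S₁ + (f c + F + S₂)            ≡⟨ lemma₁ S₁ (f c) F S₂ ⟩
            f c + (F + (S₁ + S₂))          ≡⟨ cong (λ z → f c + (F + z)) (weight-⁀ s w₁ w₂) ⟨
            f c + (F + weight s (w₁ ⁀ w₂)) ≡⟨ cong (f c +_) eq ⟩
            f c + (weight f (w₁ ⁀ w₂) + S) ≡⟨ cong (λ z → f c + (z + S)) (weight-⁀ f w₁ w₂) ⟩
            f c + (F₁ + F₂ + S)            ≡⟨ lemma₂ (f c) F₁ F₂ S ⟩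
            (F₁ + f c) + (F₂ + S)          ≡⟨ cong (_+ (F₂ + S)) (simple-cycle-balanced w₁ sw₁ e) ⟩
            (S₁ + s c) + (F₂ + S)          ≡⟨ lemma₃ S₁ (s c) F₂ S ⟩
            S₁ + (F₂ + (s c + S))          ∎)
      where
      open ≡-Reasoning
      F = weight f w ; S = weight s w
      F₁ = weight f w₁ ; F₂ = weight f w₂
      S₁ = weight s w₁ ; S₂ = weight s w₂
      lemma₁ : ∀ x y z t → x + (y + z + t) ≡ y + (z + (x + t))
      lemma₁ = solve-∀
      lemma₂ : ∀ x y z t → x + (y + z + t) ≡ (y + x) + (z + t)
      lemma₂ = solve-∀
      lemma₃ : ∀ x y z t → (x + y) + (z + t) ≡ x + (z + (y + t))
      lemma₃ = solve-∀

    -- A simple walk from `a` to `a` has no steps, so erasure leaves nothing of either weight.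
    closed-walk-balanced : ∀ {a} (w : Walk a a) → weight f w ≡ weight s w
    closed-walk-balanced w with loop-erase w
    ... | nil          , _        , eq = trans (sym (+-identityʳ _)) eq
    ... | step _ _ w′ , (av , _) , _  = contradiction refl (avoids-end w′ av)

  -- Cyclic permutations

  injective⇒surjective : ∀ {m n} (f : Fin m → Fin n) → Injective _≡_ _≡_ f → n ≤ m → ∀ y → ∃ λ x → f x ≡ y
  injective⇒surjective {m} {suc n} f inj n<m y with any? (λ x → f x ≟ y)
  ... | yes hit = hit
  ... | no  miss = contradiction (injective⇒≤ g-injective) (<⇒≱ n<m)
    where
    y≢f : ∀ x → y ≢ f x
    y≢f x eq = miss (x , sym eq)
    g-injective : Injective _≡_ _≡_ (λ x → punchOut (y≢f x))
    g-injective {x} {x′} eq = inj (punchOut-injective (y≢f x) (y≢f x′) eq)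

  all-allFin⁺ : ∀ {n} (p : Fin n → Bool) → (∀ i → T (p i)) → T (all p (allFin n))
  all-allFin⁺ p h = all⁻ p (tabulate⁺ h)

  all-allFin⁻ : ∀ {n} (p : Fin n → Bool) → T (all p (allFin n)) → ∀ i → T (p i)
  all-allFin⁻ {n} p h = tabulate⁻ (all⁺ p (allFin n) h)

  ==-true : ∀ {n} {i j : Fin n} → T (i == j) → i ≡ j
  ==-true {i = i} {j} t with i ≟ j
  ... | yes eq = eq

  ==-refl : ∀ {n} (i : Fin n) → T (i == i)
  ==-refl i rewrite dec-true (i ≟ i) refl = tt

  Cyclic : ∀ {n} → (Fin n → Fin n) → Set
  Cyclic {n} f = Injective _≡_ _≡_ f × (∀ i j → ∃ λ k → k < n × iter f k i ≡ j)

  isInjective⁻ : ∀ {n} (f : Fin n → Fin n) → T (isInjective f) → Injective _≡_ _≡_ f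
  isInjective⁻ f t {i} {j} fi≡fj with all-allFin⁻ _ (all-allFin⁻ _ t i) j
  ... | t′ rewrite dec-true (f i ≟ f j) fi≡fj = ==-true t′

  isInjective⁺ : ∀ {n} (f : Fin n → Fin n) → Injective _≡_ _≡_ f → T (isInjective f)
  isInjective⁺ f inj = all-allFin⁺ _ λ i → all-allFin⁺ _ (entry i)
    where
    entry : ∀ i j → T (not (f i == f j) ∨ (i == j))
    entry i j with f i ≟ f j
    ... | no  _  = tt
    ... | yes eq rewrite inj eq = ==-refl j

  isSingleOrbit⁻ : ∀ {n} (f : Fin n → Fin n) → T (isSingleOrbit f) → ∀ i j → ∃ λ k → k < n × iter f k i ≡ j
  isSingleOrbit⁻ {n} f t i j =
    let k , k∈ , eq = find (any⁻ _ (upTo n) (all-allFin⁻ _ (all-allFin⁻ _ t i) j)) in k , ∈-upTo⁻ k∈ , ==-true eq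

  isSingleOrbit⁺ : ∀ {n} (f : Fin n → Fin n) → (∀ i j → ∃ λ k → k < n × iter f k i ≡ j) → T (isSingleOrbit f)
  isSingleOrbit⁺ {n} f orb = all-allFin⁺ _ λ i → all-allFin⁺ _ λ j →
    let k , k<n , eq = orb i j in
    any⁺ (λ k → iter f k i == j) (lose (∈-upTo⁺ k<n) (subst (λ x → T (x == j)) (sym eq) (==-refl j)))

  allFuns-complete : ∀ k {m} (f : Fin k → Fin m) → ∃ λ g → g ∈ allFuns k m × (∀ i → g i ≡ f i)
  allFuns-complete zero    f = _ , here refl , λ ()
  allFuns-complete (suc k) f =
    let g , g∈ , g≗f = allFuns-complete k (f ∘ suc) in
    _ , ∈-concatMap⁺ _ (lose (∈-allFin (f zero)) (∈-map⁺ _ g∈)) , λ { zero → refl ; (suc i) → g≗f i }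

  iter-cong : ∀ {n} {f g : Fin n → Fin n} → (∀ i → f i ≡ g i) → ∀ k x → iter f k x ≡ iter g k x
  iter-cong         f≗g zero    x = refl
  iter-cong {g = g} f≗g (suc k) x = trans (f≗g _) (cong g (iter-cong f≗g k x))

  injective-cong : ∀ {m n} {f g : Fin m → Fin n} → (∀ i → f i ≡ g i) → Injective _≡_ _≡_ f → Injective _≡_ _≡_ g
  injective-cong f≗g inj {x} {y} eq = inj (trans (f≗g x) (trans eq (sym (f≗g y))))

  permutations-complete : ∀ {n} (f : Fin n → Fin n) → Injective _≡_ _≡_ f →
    ∃ λ g → g ∈ permutations n × (∀ i → g i ≡ f i)
  permutations-complete f inj =
    let g , g∈ , g≗f = allFuns-complete _ f in
    g , ∈-filter⁺ (T? ∘ isInjective) g∈ (isInjective⁺ g (injective-cong (sym ∘ g≗f) inj)) , g≗f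

  permutations-sound : ∀ {n} {f : Fin n → Fin n} → f ∈ permutations n → Injective _≡_ _≡_ f
  permutations-sound {n} {f} f∈ = isInjective⁻ f (proj₂ (∈-filter⁻ (T? ∘ isInjective) {xs = allFuns n n} f∈))

  nCycles-complete : ∀ {n} (f : Fin n → Fin n) → Cyclic f → ∃ λ g → g ∈ nCycles n × (∀ i → g i ≡ f i)
  nCycles-complete {n} f (inj , orb) =
    let g , g∈ , g≗f = allFuns-complete _ f
        orb′ = λ i j → let k , k<n , eq = orb i j in k , k<n , trans (iter-cong g≗f k i) eq
    in g , ∈-filter⁺ (λ f → T? (isInjective f ∧ isSingleOrbit f)) g∈
             (Equivalence.from T-∧ (isInjective⁺ g (injective-cong (sym ∘ g≗f) inj) , isSingleOrbit⁺ g orb′)) , g≗f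

  nCycles-sound : ∀ {n} {f : Fin n → Fin n} → f ∈ nCycles n → Cyclic f
  nCycles-sound {n} {f} f∈ =
    let _ , t = ∈-filter⁻ (λ f → T? (isInjective f ∧ isSingleOrbit f)) {xs = allFuns n n} f∈
        t₁ , t₂ = Equivalence.to (T-∧ {isInjective f}) t
    in isInjective⁻ f t₁ , isSingleOrbit⁻ f t₂

  iter-+ : ∀ {n} (f : Fin n → Fin n) k l x → iter f (k + l) x ≡ iter f k (iter f l x)
  iter-+ f zero    l x = refl
  iter-+ f (suc k) l x = cong f (iter-+ f k l x)

  -- The end point is kept apart from the list, so that a cyclic tour is the case where it equals
  -- the start and no vertex is listed twice.
  Chain : ∀ {a r} {A : Set a} → (A → A → Set r) → A → List A → A → Set r
  Chain R a []       b = R a b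
  Chain R a (w ∷ ws) b = R a w × Chain R w ws b

  -- Choosing a position for every element is an injection between sets of equal size, hence onto;
  -- so every position is the chosen one of its element.
  cover⇒Unique : ∀ {n} (xs : List (Fin n)) → length xs ≡ n → (∀ x → x ∈ xs) → Unique xs
  cover⇒Unique {n} xs len cover =
    subst Unique (tabulate-lookup xs) (Uniqueₚ.tabulate⁺ lookup-injective)
    where
    pos : Fin n → Fin (length xs)
    pos x = index (cover x)
    lookup-pos : ∀ x → lookup xs (pos x) ≡ x
    lookup-pos x = sym (lookup-index (cover x))
    pos-injective : Injective _≡_ _≡_ pos
    pos-injective {x} {y} eq = trans (sym (lookup-pos x)) (trans (cong (lookup xs) eq) (lookup-pos y))
    lookup-injective : ∀ {p q} → lookup xs p ≡ lookup xs q → p ≡ q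
    lookup-injective {p} {q} eq
      with injective⇒surjective pos pos-injective (≤-reflexive len) p
         | injective⇒surjective pos pos-injective (≤-reflexive len) q
    ... | x , refl | y , refl = cong pos (trans (sym (lookup-pos x)) (trans eq (lookup-pos y)))

  module _ {n : ℕ} where

    -- The default `d` is the successor of the last vertex; for a tour it is the first vertex again.
    nextIn : Fin n → Fin n → List (Fin n) → Fin n → Fin n
    nextIn d a []       k = d
    nextIn d a (w ∷ ws) k = if does (k ≟ a) then w else nextIn d w ws k

    -- Stated for any `f` that agrees with `nextIn` on the list, since the successor function of a
    -- tail differs from that of the whole list.
    chain-nextIn : ∀ d a ws (f : Fin n → Fin n) → Unique (a ∷ ws) →
      (∀ k → k ∈ a ∷ ws → f k ≡ nextIn d a ws k) → Chain (λ k l → f k ≡ l) a ws d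
    chain-nextIn d a []       f u agree = agree a (here refl)
    chain-nextIn d a (w ∷ ws) f (a∉ ∷ u) agree = first , chain-nextIn d w ws f u rest
      where
      first : f a ≡ w
      first with agree a (here refl)
      ... | eq rewrite dec-true (a ≟ a) refl = eq
      rest : ∀ k → k ∈ w ∷ ws → f k ≡ nextIn d w ws k
      rest k k∈ with agree k (there k∈)
      ... | eq rewrite dec-false (k ≟ a) (All.lookup a∉ k∈ ∘ sym) = eq

    chain-end : ∀ (f : Fin n → Fin n) a ws b → Chain (λ k l → f k ≡ l) a ws b → iter f (suc (length ws)) a ≡ b
    chain-end f a []       b r        = r
    chain-end f a (w ∷ ws) b (r , rs) =
      trans (sym (iter-shift f (suc (length ws)) a))
        (trans (cong (iter f (suc (length ws))) r) (chain-end f w ws b rs))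

    chain-iter : ∀ (f : Fin n → Fin n) a ws b → Chain (λ k l → f k ≡ l) a ws b → ∀ {x} → x ∈ a ∷ ws →
      ∃ λ p → ∃ λ r → iter f p a ≡ x × iter f (suc r) x ≡ b × p + r ≡ length ws
    chain-iter f a ws b c (here refl) = 0 , length ws , refl , chain-end f a ws b c , refl
    chain-iter f a (w ∷ ws) b (r , c) (there x∈) =
      let p , q , p→x , x→b , len = chain-iter f w ws b c x∈ in
      suc p , q , trans (sym (iter-shift f p a)) (trans (cong (iter f p) r) p→x) , x→b , cong suc len

    -- One full turn is the identity on every listed vertex, which gives injectivity; every vertex
    -- reaches every other one by way of `a`.
    chain⇒Cyclic : ∀ (f : Fin n → Fin n) a ws → Chain (λ k l → f k ≡ l) a ws a →
      (∀ x → x ∈ a ∷ ws) → suc (length ws) ≡ n → Cyclic f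
    chain⇒Cyclic f a ws c cover len = inj , orb
      where
      L = length ws
      full : ∀ x → iter f (suc L) x ≡ x
      full x with chain-iter f a ws a c (cover x)
      ... | p , r , p→x , x→a , eq =
        trans (cong (λ k → iter f k x) (trans (cong suc (sym eq)) (sym (+-suc p r))))
          (trans (iter-+ f p (suc r) x) (trans (cong (iter f p) x→a) p→x))
      inj : Injective _≡_ _≡_ f
      inj {x} {y} eq = trans (sym (full x)) (trans (trans (sym (iter-shift f L x))
        (trans (cong (iter f L) eq) (iter-shift f L y))) (full y))
      orb : ∀ i j → ∃ λ k → k < n × iter f k i ≡ j
      orb i j with chain-iter f a ws a c (cover i) | chain-iter f a ws a c (cover j)
      -- Going from `i` to `a` and on to `j` takes fewer than two full turns, so at most one turn
      -- has to be removed.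
      ... | p , r , _ , i→a , eq | p′ , r′ , a→j , _ , eq′ with p′ + suc r <? suc L
      ... | yes lt = p′ + suc r , subst (p′ + suc r <_) len lt ,
                     trans (iter-+ f p′ (suc r) i) (trans (cong (iter f p′) i→a) a→j)
      ... | no  ge = k , subst (k <_) len k<n , trans (sym (cong (iter f k) (full i)))
                       (trans (sym (iter-+ f k (suc L) i)) (trans (cong (λ z → iter f z i) (m∸n+n≡m (≮⇒≥ ge)))
                         (trans (iter-+ f p′ (suc r) i) (trans (cong (iter f p′) i→a) a→j))))
        where
        k = p′ + suc r ∸ suc L
        k<n : k < suc L
        k<n = s≤s (m≤n+o⇒m∸n≤o (p′ + suc r) (suc L) (≤-trans
                (+-mono-≤ {p′} {L} {suc r} {suc L} (m+n≤o⇒m≤o p′ (≤-reflexive eq′)) (s≤s (m+n≤o⇒n≤o p (≤-reflexive eq))))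
                (≤-reflexive (+-comm L (suc L)))))

    tour-cycle : ∀ a (ws : List (Fin n)) → (∀ x → x ∈ a ∷ ws) → suc (length ws) ≡ n →
      ∃ λ f → Cyclic f × Chain (λ k l → f k ≡ l) a ws a
    tour-cycle a ws cover len = f , chain⇒Cyclic f a ws c cover len , c
      where
      f = nextIn a a ws
      c = chain-nextIn a a ws f (cover⇒Unique (a ∷ ws) len cover) λ _ _ → refl

  chain-combine : ∀ {a r s t} {A : Set a} {R : A → A → Set r} {S : A → A → Set s} {Q : A → Set t} →
    (∀ {x y} → R x y → S x y → Q x) → ∀ x ws y → Chain R x ws y → Chain S x ws y → All Q (x ∷ ws)
  chain-combine g x []       y r        s        = g r s ∷ []
  chain-combine g x (w ∷ ws) y (r , rs) (s , ss) = g r s ∷ chain-combine g w ws y rs ss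

  -- The gadget digraph

  chain-tabulate⁺ : ∀ {a r} {A : Set a} {R : A → A → Set r} k (g : Fin (suc k) → A) zs z →
    (∀ i → R (g (inject₁ i)) (g (suc i))) → Chain R (g (fromℕ k)) zs z →
    Chain R (g zero) (tabulate (g ∘ suc) ++ zs) z
  chain-tabulate⁺ zero    g zs z r c = c
  chain-tabulate⁺ (suc k) g zs z r c = r zero , chain-tabulate⁺ k (g ∘ suc) zs z (r ∘ suc) c

  chain-tabulate⁻ : ∀ {a r} {A : Set a} {R : A → A → Set r} k (g : Fin (suc k) → A) zs z →
    Chain R (g zero) (tabulate (g ∘ suc) ++ zs) z → Chain R (g (fromℕ k)) zs z
  chain-tabulate⁻ zero    g zs z c       = c
  chain-tabulate⁻ (suc k) g zs z (_ , c) = chain-tabulate⁻ k (g ∘ suc) zs z c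

  chain-map⁻ : ∀ {a b r} {A : Set a} {B : Set b} {R : B → B → Set r} (f : A → B) x ws y →
    Chain R (f x) (map f ws) (f y) → Chain (λ x y → R (f x) (f y)) x ws y
  chain-map⁻ f x []       y r       = r
  chain-map⁻ f x (w ∷ ws) y (r , c) = r , chain-map⁻ f w ws y c

  Along : ∀ {a b r} {A : Set a} {B : Set b} → (A → B → Set r) → (B → A) → A → List B → Set r
  Along R f a []       = Level.Lift _ ⊤
  Along R f a (x ∷ xs) = R a x × Along R f (f x) xs

  along-map : ∀ {a b r s} {A : Set a} {B : Set b} {R : A → B → Set r} {S : A → B → Set s} {f : B → A} →
    (∀ {a x} → R a x → S a x) → ∀ a xs → Along R f a xs → Along S f a xs
  along-map g a []       _        = Level.lift tt
  along-map {f = f} g a (x ∷ xs) (r , rs) = g r , along-map g (f x) xs rs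

  two-cycle-covers : ∀ {n} (f : Fin n → Fin n) → Cyclic f → ∀ {x y} → f x ≡ y → f y ≡ x → ∀ z → z ≡ x ⊎ z ≡ y
  two-cycle-covers f (_ , orb) {x} {y} fx fy z with orb x z
  ... | k , _ , refl = go k
    where
    go : ∀ k → iter f k x ≡ x ⊎ iter f k x ≡ y
    go zero = inj₁ refl
    go (suc k) with go k
    ... | inj₁ eq = inj₂ (trans (cong f eq) fx)
    ... | inj₂ eq = inj₁ (trans (cong f eq) fy)

  module Gadgets (r M : ℕ) where

    N : ℕ
    N = suc M

    n : ℕ
    n = suc r + N * 3

    -- A Hamiltonian cycle crosses the vertices of each gadget consecutively, as u, v, t (forward) or as t, v, u
    -- (backward). The pads are a path that fills up the number of vertices; jumps enter a gadget at u and leave it at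
    -- t, and index 0 of inn and out is the path of pads.
    data V : Set where
      pad   : Fin (suc r) → V
      u v t : Fin N → V

    -- From here on `enc` and `dec` are used only as mutually inverse maps, so the numbering itself
    -- is sealed.
    abstract
      enc : V → Fin n
      enc (pad k) = k ↑ˡ (N * 3)
      enc (u i)   = suc r ↑ʳ combine i (zero {2})
      enc (v i)   = suc r ↑ʳ combine i (suc (zero {1}))
      enc (t i)   = suc r ↑ʳ combine i (suc (suc (zero {0})))

      gadget : Fin N × Fin 3 → V
      gadget (i , zero)           = u i
      gadget (i , suc zero)       = v i
      gadget (i , suc (suc zero)) = t i

      place : Fin (suc r) ⊎ Fin (N * 3) → V
      place (inj₁ k) = pad k
      place (inj₂ y) = gadget (remQuot 3 y)

      dec : Fin n → V
      dec x = place (splitAt (suc r) x)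

      dec-enc : ∀ x → dec (enc x) ≡ x
      dec-enc (pad k) = cong place (splitAt-↑ˡ (suc r) k (N * 3))
      dec-enc (u i)   = trans (cong place (splitAt-↑ʳ (suc r) (N * 3) _)) (cong gadget (remQuot-combine i (zero {2})))
      dec-enc (v i)   = trans (cong place (splitAt-↑ʳ (suc r) (N * 3) _)) (cong gadget (remQuot-combine i (suc (zero {1}))))
      dec-enc (t i)   = trans (cong place (splitAt-↑ʳ (suc r) (N * 3) _)) (cong gadget (remQuot-combine i (suc (suc (zero {0})))))

      enc-gadget : ∀ p → enc (gadget p) ≡ suc r ↑ʳ combine (proj₁ p) (proj₂ p)
      enc-gadget (i , zero)           = refl
      enc-gadget (i , suc zero)       = refl
      enc-gadget (i , suc (suc zero)) = refl

      enc-dec : ∀ x → enc (dec x) ≡ x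
      enc-dec x with splitAt (suc r) x in eq
      ... | inj₁ k = splitAt⁻¹-↑ˡ eq
      ... | inj₂ y = trans (enc-gadget (remQuot 3 y))
                       (trans (cong (suc r ↑ʳ_) (combine-remQuot {N} 3 y)) (splitAt⁻¹-↑ʳ eq))

    enc-injective : ∀ {x y} → enc x ≡ enc y → x ≡ y
    enc-injective eq = trans (sym (dec-enc _)) (trans (cong dec eq) (dec-enc _))

    dec-injective : ∀ {x y} → dec x ≡ dec y → x ≡ y
    dec-injective eq = trans (sym (enc-dec _)) (trans (cong enc eq) (enc-dec _))

    out inn : Fin (suc N) → V
    out zero    = pad (fromℕ r)
    out (suc i) = t i
    inn zero    = pad zero
    inn (suc i) = u i

    -- `first`, `next` and `last` serve the backward tour, which takes the gadgets in the order of
    -- their indices; this rigid order lets the direction of one gadget determine that of the next.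
    -- `jump` carries equations because `out` and `inn` are functions, so its ends could not be
    -- matched as indices.
    data Arc : V → V → Set where
      uv    : ∀ {i} → Arc (u i) (v i)
      vt    : ∀ {i} → Arc (v i) (t i)
      tv    : ∀ {i} → Arc (t i) (v i)
      vu    : ∀ {i} → Arc (v i) (u i)
      jump  : ∀ a b {x y} → x ≡ out a → y ≡ inn b → Arc x y
      pads  : ∀ {k l} → toℕ l ≡ suc (toℕ k) → Arc (pad k) (pad l)
      first : ∀ {k j} → toℕ k ≡ r → toℕ j ≡ 0 → Arc (pad k) (t j)
      next  : ∀ {i j} → toℕ j ≡ suc (toℕ i) → Arc (u i) (t j)
      last  : ∀ {i} → suc (toℕ i) ≡ N → Arc (u i) (pad zero)

    isIn isOut : V → ℕ
    isIn (pad zero)    = 1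
    isIn (pad (suc _)) = 0
    isIn (u _)         = 1
    isIn (v _)         = 0
    isIn (t _)         = 0
    isOut (pad k) = if does (k ≟ fromℕ r) then 1 else 0
    isOut (u _)   = 0
    isOut (v _)   = 0
    isOut (t _)   = 1

    isIn-inn : ∀ b → isIn (inn b) ≡ 1
    isIn-inn zero    = refl
    isIn-inn (suc _) = refl

    isOut-out : ∀ a → isOut (out a) ≡ 1
    isOut-out zero rewrite dec-true (fromℕ r ≟ fromℕ r) refl = refl
    isOut-out (suc _) = refl

    u≢out : ∀ {i} a → u i ≢ out a
    u≢out zero    ()
    u≢out (suc _) ()

    v≢out : ∀ {i} a → v i ≢ out a
    v≢out zero    ()
    v≢out (suc _) ()

    v≢inn : ∀ {i} b → v i ≢ inn b
    v≢inn zero    ()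
    v≢inn (suc _) ()

    t≢inn : ∀ {i} b → t i ≢ inn b
    t≢inn zero    ()
    t≢inn (suc _) ()

    -- Every Hamiltonian cycle is forward in all gadgets or backward in all gadgets.

    module Classification (ρ : V → V) (ρ-injective : Injective _≡_ _≡_ ρ)
      (pred : ∀ y → ∃ λ x → ρ x ≡ y) (arc : ∀ x → Arc x (ρ x))
      (two-cycle : ∀ {x y} → ρ x ≡ y → ρ y ≡ x → ∀ z → z ≡ x ⊎ z ≡ y) where

      Fwd Bwd : Fin N → Set
      Fwd i = ρ (u i) ≡ v i × ρ (v i) ≡ t i
      Bwd i = ρ (t i) ≡ v i × ρ (v i) ≡ u i

      conflict : ∀ {x x′ y} → ρ x ≡ y → ρ x′ ≡ y → x ≢ x′ → ⊥
      conflict p q x≢x′ = x≢x′ (ρ-injective (trans p (sym q)))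

      clash : ∀ {x y y′} → ρ x ≡ y → ρ x ≡ y′ → y ≢ y′ → ⊥
      clash p q y≢y′ = y≢y′ (trans (sym p) q)

      v-succ : ∀ i → ρ (v i) ≡ t i ⊎ ρ (v i) ≡ u i
      v-succ i with ρ (v i) | arc (v i)
      ... | _ | vt = inj₁ refl
      ... | _ | vu = inj₂ refl
      ... | _ | jump a b p _ = ⊥-elim (v≢out a p)

      v-pred : ∀ i → ρ (u i) ≡ v i ⊎ ρ (t i) ≡ v i
      v-pred i with pred (v i)
      ... | x , eq with subst (Arc x) eq (arc x)
      ...   | uv = inj₁ eq
      ...   | tv = inj₂ eq
      ...   | jump a b _ p = ⊥-elim (v≢inn b p)

      -- The only neighbours of `v i` are `u i` and `t i`. Entering and leaving through the same one
      -- would close a cycle of length two that misses the other.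
      direction : ∀ i → Fwd i ⊎ Bwd i
      direction i with v-succ i | v-pred i
      ... | inj₁ vt≡ | inj₁ uv≡ = inj₁ (uv≡ , vt≡)
      ... | inj₂ vu≡ | inj₂ tv≡ = inj₂ (tv≡ , vu≡)
      ... | inj₁ vt≡ | inj₂ tv≡ with two-cycle vt≡ tv≡ (u i)
      ...   | inj₁ ()
      ...   | inj₂ ()
      direction i | inj₂ vu≡ | inj₁ uv≡ with two-cycle vu≡ uv≡ (t i)
      ...   | inj₁ ()
      ...   | inj₂ ()

      -- If gadget `j` were backward, `t j` could only be entered from `u i`, but `u i` already
      -- leads to `v i`.
      fwd-up : ∀ {i j} → toℕ j ≡ suc (toℕ i) → Fwd i → Fwd j
      fwd-up {i} {j} j≡ (uv≡ , vt≡) with direction j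
      ... | inj₁ fwd = fwd
      ... | inj₂ (tv≡ , vu≡) with pred (t j)
      ...   | x , eq with subst (Arc x) eq (arc x)
      ...     | vt = ⊥-elim (clash vu≡ eq λ ())
      ...     | jump a b _ p = ⊥-elim (t≢inn b p)
      ...     | first _ j≡0 with trans (sym j≡) j≡0
      ...       | ()
      fwd-up {i} {j} j≡ (uv≡ , vt≡) | inj₂ (tv≡ , vu≡) | x , eq | next {i′} j≡′
        with toℕ-injective (suc-injective (trans (sym j≡) j≡′))
      ... | refl = ⊥-elim (clash uv≡ eq λ ())

      -- If gadget `j` were forward, `u i` would have no successor left: `v i` is entered from
      -- `t i`, and `t j` from `v j`.
      bwd-up : ∀ {i j} → toℕ j ≡ suc (toℕ i) → Bwd i → Bwd j
      bwd-up {i} {j} j≡ (tv≡ , vu≡) with direction j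
      ... | inj₂ bwd = bwd
      ... | inj₁ (uv≡′ , vt≡′) with ρ (u i) in eq | arc (u i)
      ...   | _ | uv = ⊥-elim (conflict eq tv≡ λ ())
      ...   | _ | jump a b p _ = ⊥-elim (u≢out a p)
      ...   | _ | last i≡ = ⊥-elim (<-irrefl (trans j≡ i≡) (toℕ<n j))
      ...   | _ | next {j = j′} j≡′ with toℕ-injective (trans j≡ (sym j≡′))
      ...     | refl = ⊥-elim (conflict eq vt≡′ λ ())

      -- In the forward case the other possible successors of `out a` already have predecessors, so
      -- only a jump remains. In the backward case `t i` returns to `v i`, and the last pad is the
      -- only possible predecessor of `t zero`.
      row : ∀ {ε} → (∀ i → (Fwd i × ε ≡ 1) ⊎ (Bwd i × ε ≡ 0)) → ∀ a → isIn (ρ (out a)) ≡ ε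
      row d (suc i) with d i
      ... | inj₂ ((tv≡ , _) , refl) = cong isIn tv≡
      ... | inj₁ ((uv≡ , _) , refl) with ρ (t i) in eq | arc (t i)
      ...   | _ | tv = ⊥-elim (conflict uv≡ eq λ ())
      ...   | _ | jump a b _ p = trans (cong isIn p) (isIn-inn b)
      row d zero with d zero
      ... | inj₁ ((_ , vt≡) , refl) with ρ (pad (fromℕ r)) in eq | arc (pad (fromℕ r))
      ...   | _ | jump a b _ p = trans (cong isIn p) (isIn-inn b)
      ...   | _ | pads {l = l} l≡ = ⊥-elim (<-irrefl (trans l≡ (cong suc (toℕ-fromℕ r))) (toℕ<n l))
      ...   | _ | first {j = zero} _ _ = ⊥-elim (conflict eq vt≡ λ ())
      row d zero | inj₂ ((_ , vu≡) , refl) with pred (t zero)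
      ... | x , eq with subst (Arc x) eq (arc x)
      ...   | vt = ⊥-elim (clash vu≡ eq λ ())
      ...   | jump a b _ p = ⊥-elim (t≢inn b p)
      ...   | first {k} k≡ _ with toℕ-injective (trans k≡ (sym (toℕ-fromℕ r)))
      ...     | refl = cong isIn eq

      -- The mirror image of `row`; the last gadget, with index `fromℕ M`, now plays the part of
      -- gadget `zero`.
      col : ∀ {ε} → (∀ i → (Fwd i × ε ≡ 1) ⊎ (Bwd i × ε ≡ 0)) → ∀ b {y} → ρ y ≡ inn b → isOut y ≡ ε
      col d (suc i) {y} eq with d i
      ... | inj₂ ((_ , vu≡) , refl) = cong isOut (ρ-injective (trans eq (sym vu≡)))
      ... | inj₁ ((_ , vt≡) , refl) with subst (Arc y) eq (arc y)
      ...   | vu = ⊥-elim (clash vt≡ eq λ ())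
      ...   | jump a b p _ = trans (cong isOut p) (isOut-out a)
      col d zero {y} eq with d (fromℕ M)
      ... | inj₁ ((uv≡ , _) , refl) with subst (Arc y) eq (arc y)
      ...   | jump a b p _ = trans (cong isOut p) (isOut-out a)
      ...   | last {i} i≡ with toℕ-injective (trans (suc-injective i≡) (sym (toℕ-fromℕ M)))
      ...     | refl = ⊥-elim (clash uv≡ eq λ ())
      col d zero {y} eq | inj₂ ((tv≡ , _) , refl) with ρ (u (fromℕ M)) in eq′ | arc (u (fromℕ M))
      ... | _ | uv = ⊥-elim (conflict eq′ tv≡ λ ())
      ... | _ | jump a b p _ = ⊥-elim (u≢out a p)
      ... | _ | next {j = j} j≡ = ⊥-elim (<-irrefl (trans j≡ (cong suc (toℕ-fromℕ M))) (toℕ<n j))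
      ... | _ | last _ = cong isOut (ρ-injective (trans eq (sym eq′)))

      dichotomy : ∃ λ ε → (∀ a → isIn (ρ (out a)) ≡ ε) × (∀ b {y} → ρ y ≡ inn b → isOut y ≡ ε)
      dichotomy with direction zero
      ... | inj₁ fwd₀ = 1 , row d , col d
        where
        d : ∀ i → (Fwd i × 1 ≡ 1) ⊎ (Bwd i × 1 ≡ 0)
        d i = inj₁ (<-weakInduction Fwd fwd₀ (λ i → fwd-up (cong suc (sym (toℕ-inject₁ i)))) i , refl)
      ... | inj₂ bwd₀ = 0 , row d , col d
        where
        d : ∀ i → (Fwd i × 0 ≡ 1) ⊎ (Bwd i × 0 ≡ 0)
        d i = inj₂ (<-weakInduction Bwd bwd₀ (λ i → bwd-up (cong suc (sym (toℕ-inject₁ i)))) i , refl)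

    Lab : Set
    Lab = Maybe (Fin n × Fin n)

    -- The jumps leaving out a and those entering inn b; no other arc goes from an out to an inn vertex.
    rowW colW : Fin (suc N) → Lab → ℕ
    rowW a nothing        = 0
    rowW a (just (k , l)) = if does (k ≟ enc (out a)) then isIn (dec l) else 0
    colW b nothing        = 0
    colW b (just (k , l)) = if does (l ≟ enc (inn b)) then isOut (dec k) else 0

    IsArc : Fin n → Fin n → Set
    IsArc k l = Arc (dec k) (dec l)

    Respects : (Fin n → Fin n) → Set
    Respects σ = ∀ k → IsArc k (σ k)

    sum-rowW : ∀ (σ : Fin n → Fin n) a → sum (λ k → rowW a (just (k , σ k))) ≡ isIn (dec (σ (enc (out a))))
    sum-rowW σ a = trans (sum-pick (λ k → rowW a (just (k , σ k))) (enc (out a)) off) on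
      where
      off : ∀ i → i ≢ enc (out a) → rowW a (just (i , σ i)) ≡ 0
      off i i≢ rewrite dec-false (i ≟ enc (out a)) i≢ = refl
      on : rowW a (just (enc (out a) , σ (enc (out a)))) ≡ isIn (dec (σ (enc (out a))))
      on rewrite dec-true (enc (out a) ≟ enc (out a)) refl = refl

    sum-colW : ∀ (σ : Fin n → Fin n) → Injective _≡_ _≡_ σ → ∀ b y → σ y ≡ enc (inn b) →
      sum (λ k → colW b (just (k , σ k))) ≡ isOut (dec y)
    sum-colW σ inj b y σy = trans (sum-pick (λ k → colW b (just (k , σ k))) y off) on
      where
      off : ∀ i → i ≢ y → colW b (just (i , σ i)) ≡ 0
      off i i≢ rewrite dec-false (σ i ≟ enc (inn b)) (λ eq → i≢ (inj (trans eq (sym σy)))) = refl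
      on : colW b (just (y , σ y)) ≡ isOut (dec y)
      on rewrite dec-true (σ y ≟ enc (inn b)) σy = refl

    -- This will be applied to cycles read off from unknown matchings. The point is that one
    -- constant `ε` serves all rows and all columns at once.
    cycle-balanced : ∀ (σ : Fin n → Fin n) → Cyclic σ → Respects σ → ∃ λ ε →
      (∀ a → sum (λ k → rowW a (just (k , σ k))) ≡ ε) × (∀ b → sum (λ k → colW b (just (k , σ k))) ≡ ε)
    cycle-balanced σ cyc@(inj , _) resp = ε , (λ a → trans (sum-rowW σ a) (rows a)) , colsum
      where
      ρ : V → V
      ρ x = dec (σ (enc x))
      pre : ∀ y → ∃ λ x → σ x ≡ y
      pre = injective⇒surjective σ inj ≤-refl
      pred : ∀ y → ∃ λ x → ρ x ≡ y
      pred y with pre (enc y)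
      ... | x , eq = dec x , trans (cong (dec ∘ σ) (enc-dec x)) (trans (cong dec eq) (dec-enc y))
      two : ∀ {x y} → ρ x ≡ y → ρ y ≡ x → ∀ z → z ≡ x ⊎ z ≡ y
      two {x} {y} p q z with two-cycle-covers σ cyc {enc x} {enc y}
        (trans (sym (enc-dec _)) (cong enc p)) (trans (sym (enc-dec _)) (cong enc q)) (enc z)
      ... | inj₁ eq = inj₁ (enc-injective eq)
      ... | inj₂ eq = inj₂ (enc-injective eq)
      module C = Classification ρ (enc-injective ∘ inj ∘ dec-injective) pred
        (λ x → subst (λ z → Arc z (ρ x)) (dec-enc x) (resp (enc x))) two
      ε = proj₁ C.dichotomy
      rows = proj₁ (proj₂ C.dichotomy)
      cols = proj₂ (proj₂ C.dichotomy)
      colsum : ∀ b → sum (λ k → colW b (just (k , σ k))) ≡ ε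
      colsum b with pre (enc (inn b))
      ... | y , eq = trans (sum-colW σ inj b y eq)
              (cols b {dec y} (trans (cong (dec ∘ σ) (enc-dec y)) (trans (cong dec eq) (dec-enc (inn b)))))

    -- Construction of the forward and backward tours.

    fwdBlocks bwdBlocks : List (Fin N) → List V
    fwdBlocks []       = []
    fwdBlocks (x ∷ xs) = u x ∷ v x ∷ t x ∷ fwdBlocks xs
    bwdBlocks []       = []
    bwdBlocks (x ∷ xs) = t x ∷ v x ∷ u x ∷ bwdBlocks xs

    padsThen : List V → List V
    padsThen ws = tabulate (pad ∘ suc) ++ ws

    length-fwd : ∀ xs → length (fwdBlocks xs) ≡ length xs * 3
    length-fwd []       = refl
    length-fwd (x ∷ xs) = cong (3 +_) (length-fwd xs)

    length-bwd : ∀ xs → length (bwdBlocks xs) ≡ length xs * 3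
    length-bwd []       = refl
    length-bwd (x ∷ xs) = cong (3 +_) (length-bwd xs)

    ∈-fwd : ∀ {x xs} → x ∈ xs → u x ∈ fwdBlocks xs × v x ∈ fwdBlocks xs × t x ∈ fwdBlocks xs
    ∈-fwd (here refl) = here refl , there (here refl) , there (there (here refl))
    ∈-fwd (there x∈)  = let a , b , c = ∈-fwd x∈ in there (there (there a)) , there (there (there b)) , there (there (there c))

    ∈-bwd : ∀ {x xs} → x ∈ xs → u x ∈ bwdBlocks xs × v x ∈ bwdBlocks xs × t x ∈ bwdBlocks xs
    ∈-bwd (here refl) = there (there (here refl)) , there (here refl) , here refl
    ∈-bwd (there x∈)  = let a , b , c = ∈-bwd x∈ in there (there (there a)) , there (there (there b)) , there (there (there c))

    ∈-padsThen : ∀ ws → (∀ i → u i ∈ ws × v i ∈ ws × t i ∈ ws) → ∀ x → x ∈ pad zero ∷ padsThen ws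
    ∈-padsThen ws h (pad zero)    = here refl
    ∈-padsThen ws h (pad (suc k)) = there (∈-++⁺ˡ (∈-tabulate⁺ k))
    ∈-padsThen ws h (u i) = there (∈-++⁺ʳ (tabulate (pad ∘ suc)) (proj₁ (h i)))
    ∈-padsThen ws h (v i) = there (∈-++⁺ʳ (tabulate (pad ∘ suc)) (proj₁ (proj₂ (h i))))
    ∈-padsThen ws h (t i) = there (∈-++⁺ʳ (tabulate (pad ∘ suc)) (proj₂ (proj₂ (h i))))

    tour : ∀ ws → Chain Arc (pad (fromℕ r)) ws (pad zero) → length ws ≡ N * 3 →
      (∀ i → u i ∈ ws × v i ∈ ws × t i ∈ ws) →
      ∃ λ σ → Cyclic σ × Respects σ × Chain (λ x y → σ (enc x) ≡ enc y) (pad (fromℕ r)) ws (pad zero)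
    tour ws c len h =
      let σ , cyc , cσ = tour-cycle (enc (pad zero)) (map enc (padsThen ws)) cover total
          cσV = chain-map⁻ enc (pad zero) (padsThen ws) (pad zero) cσ
      in σ , cyc , respects σ cσV , chain-tabulate⁻ r pad ws (pad zero) cσV
      where
      cover : ∀ x → x ∈ enc (pad zero) ∷ map enc (padsThen ws)
      cover x = subst (_∈ enc (pad zero) ∷ map enc (padsThen ws)) (enc-dec x)
                  (∈-map⁺ enc (∈-padsThen ws h (dec x)))
      total : suc (length (map enc (padsThen ws))) ≡ n
      total = cong suc (trans (length-map enc (padsThen ws)) (trans (length-++ (tabulate (pad ∘ suc)))
                (cong₂ _+_ (length-tabulate (pad ∘ suc)) len)))
      cArc : Chain Arc (pad zero) (padsThen ws) (pad zero)
      cArc = chain-tabulate⁺ r pad ws (pad zero) (λ i → pads (cong suc (sym (toℕ-inject₁ i)))) c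
      respects : ∀ σ → Chain (λ x y → σ (enc x) ≡ enc y) (pad zero) (padsThen ws) (pad zero) → Respects σ
      respects σ cσV k = subst (λ z → Arc (dec k) (dec (σ z))) (enc-dec k)
        (All.lookup (chain-combine (λ {x} {y} e eq → subst (Arc x) (trans (sym (dec-enc y)) (cong dec (sym eq))) e)
          (pad zero) (padsThen ws) (pad zero) cArc cσV) (∈-padsThen ws h (dec k)))

    fwd-chain : ∀ a xs → Chain Arc (out a) (fwdBlocks xs) (pad zero)
    fwd-chain a []       = jump a zero refl refl
    fwd-chain a (x ∷ xs) = jump a (suc x) refl refl , uv , vt , fwd-chain (suc x) xs

    bwd-chain : ∀ x xs → Chain (λ a b → b ≡ suc a) (toℕ x) (map toℕ xs) N → Chain Arc (u x) (bwdBlocks xs) (pad zero)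
    bwd-chain x []       e       = last (sym e)
    bwd-chain x (y ∷ ys) (e , c) = next e , tv , vu , bwd-chain y ys c

    Visits : (Fin n → Fin n) → Fin (suc N) → List (Fin N) → Set
    Visits σ = Along (λ a x → σ (enc (out a)) ≡ enc (inn (suc x))) suc

    fwd-visits : ∀ σ a xs → Chain (λ x y → σ (enc x) ≡ enc y) (out a) (fwdBlocks xs) (pad zero) → Visits σ a xs
    fwd-visits σ a []       _                 = Level.lift tt
    fwd-visits σ a (x ∷ xs) (e , _ , _ , c) = e , fwd-visits σ (suc x) xs c

    fwd-tour : ∀ xs → length xs ≡ N → (∀ i → i ∈ xs) →
      ∃ λ σ → Cyclic σ × Respects σ × Visits σ zero xs
    fwd-tour xs len cover =
      let σ , cyc , resp , c = tour (fwdBlocks xs) (fwd-chain zero xs)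
                                 (trans (length-fwd xs) (cong (_* 3) len)) (λ i → ∈-fwd (cover i)) in
      σ , cyc , resp , fwd-visits σ zero xs c

    -- The recorded arc shows that the last pad does not jump, which forces the constant of
    -- `cycle-balanced` to be 0 for this tour.
    bwd-tour : ∃ λ σ → Cyclic σ × Respects σ × σ (enc (out zero)) ≡ enc (t zero)
    bwd-tour =
      let σ , cyc , resp , e , _ = tour (bwdBlocks (allFin N)) chain
                                 (trans (length-bwd (allFin N)) (cong (_* 3) (length-tabulate {n = N} id))) (λ i → ∈-bwd (∈-allFin i)) in
      σ , cyc , resp , e
      where
      indices : Chain (λ a b → b ≡ suc a) 0 (tabulate {n = M} (toℕ ∘ suc) ++ []) N
      indices = chain-tabulate⁺ M toℕ [] N (λ i → cong suc (sym (toℕ-inject₁ i))) (cong suc (sym (toℕ-fromℕ M)))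
      chain : Chain Arc (pad (fromℕ r)) (bwdBlocks (allFin N)) (pad zero)
      chain = first (toℕ-fromℕ r) refl , tv , vu , bwd-chain zero (tabulate {n = M} suc)
        (subst (λ ws → Chain (λ a b → b ≡ suc a) 0 ws N)
          (trans (++-identityʳ _) (sym (map-tabulate {n = M} suc toℕ))) indices)

  -- Counting orderings

  𝟙 : Bool → ℕ
  𝟙 b = if b then 1 else 0

  agree : Bool → Bool → Bool
  agree true  b = b
  agree false b = not b

  count : ∀ {a} {A : Set a} → (A → Bool) → List A → ℕ
  count p []       = 0
  count p (x ∷ xs) = 𝟙 (p x) + count p xs

  module _ {a} {A : Set a} where

    count-++ : ∀ (p : A → Bool) xs ys → count p (xs ++ ys) ≡ count p xs + count p ys
    count-++ p []       ys = refl
    count-++ p (x ∷ xs) ys = trans (cong (𝟙 (p x) +_) (count-++ p xs ys)) (sym (+-assoc (𝟙 (p x)) _ _))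

    count-map : ∀ {b} {B : Set b} (p : A → Bool) (f : B → A) xs → count p (map f xs) ≡ count (p ∘ f) xs
    count-map p f []       = refl
    count-map p f (x ∷ xs) = cong (𝟙 (p (f x)) +_) (count-map p f xs)

    count-none : ∀ xs → count {A = A} (λ _ → false) xs ≡ 0
    count-none []       = refl
    count-none (x ∷ xs) = count-none xs

    count-mono : ∀ (p q : A → Bool) xs → (∀ {x} → x ∈ xs → T (p x) → T (q x)) → count p xs ≤ count q xs
    count-mono p q []       h = z≤n
    count-mono p q (x ∷ xs) h = +-mono-≤ (head (p x) (q x) (h (here refl))) (count-mono p q xs (h ∘ there))
      where
      head : ∀ b c → (T b → T c) → 𝟙 b ≤ 𝟙 c
      head false c     t = z≤n
      head true  true  t = ≤-refl
      head true  false t = contradiction (t tt) λ ()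

    count-witness : ∀ (p : A → Bool) xs → count p xs ≡ 0 ⊎ ∃ λ x → x ∈ xs × T (p x)
    count-witness p [] = inj₁ refl
    count-witness p (x ∷ xs) with p x in eq
    ... | true  = inj₂ (x , here refl , subst T (sym eq) tt)
    ... | false with count-witness p xs
    ...   | inj₁ z             = inj₁ z
    ...   | inj₂ (y , y∈ , t) = inj₂ (y , there y∈ , t)

    count-concatMap-≤ : ∀ {b} {B : Set b} (p : A → Bool) (F : B → List A) (q : B → Bool) bound xs →
      (∀ {x} → x ∈ xs → count p (F x) ≤ 𝟙 (q x) * bound) → count p (concatMap F xs) ≤ count q xs * bound
    count-concatMap-≤ p F q bound []       h = z≤n
    count-concatMap-≤ p F q bound (x ∷ xs) h =
      subst₂ _≤_ (sym (count-++ p (F x) (concatMap F xs))) (sym (*-distribʳ-+ bound (𝟙 (q x)) (count q xs)))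
        (+-mono-≤ (h (here refl)) (count-concatMap-≤ p F q bound xs (h ∘ there)))

    length-fibres : ∀ {K} (key : A → Fin K) xs → length xs ≡ sum (λ k → count (λ x → key x == k) xs)
    length-fibres {K} key []   = sym (sum-zero {K} λ _ → refl)
    length-fibres key (x ∷ xs) = sym (trans (∑-distrib-+ (λ k → 𝟙 (key x == k)) (λ k → count (λ x → key x == k) xs))
      (cong₂ _+_ one (sym (length-fibres key xs))))
      where
      one : sum (λ k → 𝟙 (key x == k)) ≡ 1
      one = trans (sum-pick _ (key x) λ k k≢ → cong 𝟙 (dec-false (key x ≟ k) (k≢ ∘ sym)))
                  (cong 𝟙 (dec-true (key x ≟ key x) refl))

    fibres-bound : ∀ {K} (key : A → Fin K) bound xs → (∀ k → count (λ x → key x == k) xs ≤ bound) →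
      length xs ≤ K * bound
    fibres-bound key bound xs h = subst (_≤ _) (sym (length-fibres key xs)) (sum-≤ _ h)
      where
      sum-≤ : ∀ {K} (g : Fin K → ℕ) → (∀ k → g k ≤ bound) → sum g ≤ K * bound
      sum-≤ {zero}  g h = z≤n
      sum-≤ {suc K} g h = +-mono-≤ (h zero) (sum-≤ (g ∘ suc) (h ∘ suc))

  -- Orderings that map one set into another.

  module _ {a} {A : Set a} where

    selections : ∀ {n} → Vec A (suc n) → List (A × Vec A n)
    selections (x ∷ [])     = (x , []) ∷ []
    selections (x ∷ y ∷ ys) = (x , y ∷ ys) ∷ map (λ (z , r) → z , x ∷ r) (selections (y ∷ ys))

    orderings : ∀ {n} → Vec A n → List (List A)
    orderings {zero}  [] = [] ∷ []
    orderings {suc n} xs = concatMap (λ (x , r) → map (x ∷_) (orderings r)) (selections xs)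

    length-selections : ∀ {n} (xs : Vec A (suc n)) → length (selections xs) ≡ suc n
    length-selections (x ∷ [])     = refl
    length-selections (x ∷ y ∷ ys) = cong suc (trans (length-map _ (selections (y ∷ ys))) (length-selections (y ∷ ys)))

    length-orderings : ∀ {n} (xs : Vec A n) → length (orderings xs) ≡ n !
    length-orderings {zero}  [] = refl
    length-orderings {suc n} xs = trans (go (selections xs)) (cong (_* n !) (length-selections xs))
      where
      go : ∀ ss → length (concatMap (λ (x , r) → map (x ∷_) (orderings {n} r)) ss) ≡ length ss * n !
      go []             = refl
      go ((x , r) ∷ ss) = trans (length-++ (map (x ∷_) (orderings r)))
        (cong₂ _+_ (trans (length-map _ (orderings r)) (length-orderings r)) (go ss))

    ∈-selections : ∀ {n} (xs : Vec A (suc n)) {y r} → (y , r) ∈ selections xs →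
      ∀ {x} → x Vecₘ.∈ xs → x ≡ y ⊎ x Vecₘ.∈ r
    ∈-selections (x ∷ [])     (here refl) (VecAny.here refl) = inj₁ refl
    ∈-selections (x ∷ y ∷ ys) (here refl) (VecAny.here refl) = inj₁ refl
    ∈-selections (x ∷ y ∷ ys) (here refl) (VecAny.there x∈)  = inj₂ x∈
    ∈-selections (x ∷ y ∷ ys) (there s∈)  x∈ with ∈-map⁻ _ s∈ | x∈
    ... | (z , r) , z∈ , refl | VecAny.here refl = inj₂ (VecAny.here refl)
    ... | (z , r) , z∈ , refl | VecAny.there x∈′ with ∈-selections (y ∷ ys) z∈ x∈′
    ...   | inj₁ eq  = inj₁ eq
    ...   | inj₂ x∈r = inj₂ (VecAny.there x∈r)

    orderings-sound : ∀ {n} (xs : Vec A n) {ys} → ys ∈ orderings xs →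
      length ys ≡ n × (∀ {x} → x Vecₘ.∈ xs → x ∈ ys)
    orderings-sound {zero}  [] (here refl) = refl , λ ()
    orderings-sound {suc n} xs ys∈ with find (∈-concatMap⁻ _ {xs = selections xs} ys∈)
    ... | (y , r) , s∈ , ys∈′ with ∈-map⁻ _ ys∈′
    ...   | zs , zs∈ , refl = cong suc (proj₁ (orderings-sound r zs∈)) , mem
      where
      mem : ∀ {x} → x Vecₘ.∈ xs → x ∈ y ∷ zs
      mem x∈ with ∈-selections xs s∈ x∈
      ... | inj₁ refl = here refl
      ... | inj₂ x∈r  = there (proj₂ (orderings-sound r zs∈) x∈r)

    vcount : (A → Bool) → ∀ {n} → Vec A n → ℕ
    vcount p []       = 0
    vcount p (x ∷ xs) = 𝟙 (p x) + vcount p xs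

    vcount-cong : ∀ {p q : A → Bool} → (∀ x → p x ≡ q x) → ∀ {n} (xs : Vec A n) → vcount p xs ≡ vcount q xs
    vcount-cong p≗q []       = refl
    vcount-cong p≗q (x ∷ xs) = cong₂ _+_ (cong 𝟙 (p≗q x)) (vcount-cong p≗q xs)

    vcount-complement : ∀ (p : A → Bool) {n} (xs : Vec A n) → vcount p xs + vcount (not ∘ p) xs ≡ n
    vcount-complement p [] = refl
    vcount-complement p (x ∷ xs) with p x
    ... | true  = cong suc (vcount-complement p xs)
    ... | false = trans (+-suc _ _) (cong suc (vcount-complement p xs))

    vcount-tabulate : ∀ (p : A → Bool) {n} (g : Fin n → A) → vcount p (Vec.tabulate g) ≡ sum (𝟙 ∘ p ∘ g)
    vcount-tabulate p {zero}  g = refl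
    vcount-tabulate p {suc n} g = cong (𝟙 (p (g zero)) +_) (vcount-tabulate p (g ∘ suc))

    vcount-selection : ∀ (p : A → Bool) {n} (xs : Vec A (suc n)) {y r} → (y , r) ∈ selections xs →
      𝟙 (p y) + vcount p r ≡ vcount p xs
    vcount-selection p (x ∷ [])     (here refl) = refl
    vcount-selection p (x ∷ y ∷ ys) (here refl) = refl
    vcount-selection p (x ∷ y ∷ ys) (there s∈) with ∈-map⁻ _ s∈
    ... | (z , r) , z∈ , refl =
      trans (lemma (𝟙 (p z)) (𝟙 (p x)) (vcount p r)) (cong (𝟙 (p x) +_) (vcount-selection p (y ∷ ys) z∈))
      where
      lemma : ∀ a b c → a + (b + c) ≡ b + (a + c)
      lemma = solve-∀

    count-selections : ∀ (p : A → Bool) {n} (xs : Vec A (suc n)) → count (p ∘ proj₁) (selections xs) ≡ vcount p xs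
    count-selections p (x ∷ [])     = refl
    count-selections p (x ∷ y ∷ ys) = cong (𝟙 (p x) +_)
      (trans (count-map (p ∘ proj₁) _ (selections (y ∷ ys))) (count-selections p (y ∷ ys)))

    module _ (I J : A → Bool) where

      -- `b` tells whether the current source lies in `I`; the next gadget must then lie in `J`, and
      -- otherwise outside it.
      consistent : Bool → List A → Bool
      consistent b []       = true
      consistent b (x ∷ xs) = agree (J x) b ∧ consistent (I x) xs

      count-consistent-step : ∀ {n} b (xs : Vec A (suc n)) bound →
        (∀ {y r} → (y , r) ∈ selections xs → T (agree (J y) b) → count (consistent (I y)) (orderings r) ≤ bound) →
        count (consistent b) (orderings xs) ≤ vcount (λ x → agree (J x) b) xs * bound
      count-consistent-step b xs bound h =
        subst (λ k → count (consistent b) (orderings xs) ≤ k * bound) (count-selections (λ x → agree (J x) b) xs)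
          (count-concatMap-≤ _ _ (λ s → agree (J (proj₁ s)) b) bound (selections xs) step)
        where
        step : ∀ {s} → s ∈ selections xs →
          count (consistent b) (map (proj₁ s ∷_) (orderings (proj₂ s))) ≤ 𝟙 (agree (J (proj₁ s)) b) * bound
        step {y , r} s∈ rewrite count-map (consistent b) (y ∷_) (orderings r) with agree (J y) b | h s∈
        ... | false | _  = ≤-reflexive (count-none (orderings r))
        ... | true  | h′ = ≤-trans (h′ tt) (≤-reflexive (sym (+-identityʳ bound)))

      -- Whether the next gadget lies in `J` is forced by the previous one. So the members of `J`
      -- are drawn without replacement, and so are the others; the interleaving varies, but the
      -- product of the numbers of choices is always bounded by the two factorials.
      count-consistent : ∀ {n} b (xs : Vec A n) →
        count (consistent b) (orderings xs) ≤ vcount J xs ! * vcount (not ∘ J) xs !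
      count-consistent {zero} b [] = ≤-refl
      count-consistent {suc n} true xs = bound (vcount J xs) refl
        where
        l = vcount (not ∘ J) xs
        J≗ : ∀ x → agree (J x) true ≡ J x
        J≗ x with J x
        ... | true  = refl
        ... | false = refl
        rest : ∀ j → vcount J xs ≡ j → ∀ {y r} → (y , r) ∈ selections xs → T (agree (J y) true) →
          count (consistent (I y)) (orderings r) ≤ (j ∸ 1) ! * l !
        rest j eq {y} {r} s∈ Jy with J y | vcount-selection J xs s∈ | vcount-selection (not ∘ J) xs s∈
        ... | true | e | e′ = subst₂ (λ a b → count (consistent (I y)) (orderings r) ≤ a ! * b !)
                                (cong (_∸ 1) (trans e eq)) e′ (count-consistent (I y) r)
        bound : ∀ j → vcount J xs ≡ j → count (consistent true) (orderings xs) ≤ j ! * l !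
        bound j eq = ≤-trans (count-consistent-step true xs _ (rest j eq))
          (≤-trans (≤-reflexive (cong (_* ((j ∸ 1) ! * l !)) (trans (vcount-cong J≗ xs) eq))) (absorb j))
          where
          -- For `j` = 0 the truncated predecessor is harmless: the number of choices, and with it
          -- the left side, is 0.
          absorb : ∀ j → j * ((j ∸ 1) ! * l !) ≤ j ! * l !
          absorb zero    = z≤n
          absorb (suc j) = ≤-reflexive (sym (*-assoc (suc j) (j !) (l !)))
      count-consistent {suc n} false xs = bound (vcount (not ∘ J) xs) refl
        where
        j = vcount J xs
        J≗ : ∀ x → agree (J x) false ≡ not (J x)
        J≗ x with J x
        ... | true  = refl
        ... | false = refl
        rest : ∀ l → vcount (not ∘ J) xs ≡ l → ∀ {y r} → (y , r) ∈ selections xs → T (agree (J y) false) →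
          count (consistent (I y)) (orderings r) ≤ j ! * (l ∸ 1) !
        rest l eq {y} {r} s∈ Jy with J y | vcount-selection J xs s∈ | vcount-selection (not ∘ J) xs s∈
        ... | false | e | e′ = subst₂ (λ a b → count (consistent (I y)) (orderings r) ≤ a ! * b !)
                                 e (cong (_∸ 1) (trans e′ eq)) (count-consistent (I y) r)
        bound : ∀ l → vcount (not ∘ J) xs ≡ l → count (consistent false) (orderings xs) ≤ j ! * l !
        bound l eq = ≤-trans (count-consistent-step false xs _ (rest l eq))
          (≤-trans (≤-reflexive (cong (_* (j ! * (l ∸ 1) !)) (trans (vcount-cong J≗ xs) eq))) (absorb l))
          where
          lemma : ∀ a b c → a * (b * c) ≡ b * (a * c)
          lemma = solve-∀
          absorb : ∀ l → l * (j ! * (l ∸ 1) !) ≤ j ! * l !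
          absorb zero    = z≤n
          absorb (suc l) = ≤-reflexive (lemma (suc l) (j !) (l !))

  -- Raising `h` by one multiplies the right side by (2h+2)(2h+1), which is at least the factor
  -- 2(h+1)(h+1) of the left side.
  central-factorial : ∀ h → 2 ^ h * (h ! * h !) ≤ (h + h) !
  central-factorial zero    = ≤-refl
  central-factorial (suc h) = begin
    2 * 2 ^ h * ((suc h * h !) * (suc h * h !))       ≡⟨ lemma (2 ^ h) (suc h) (h !) ⟩
    (suc h + suc h) * (suc h * (2 ^ h * (h ! * h !)))  ≤⟨ *-monoʳ-≤ (suc h + suc h) (*-mono-≤ (s≤s (m≤n+m h h)) (central-factorial h)) ⟩
    (suc h + suc h) * suc (h + h) !                    ≡⟨ cong (λ k → (suc h + suc h) * k) (cong _! (+-suc h h)) ⟨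
    (suc h + suc h) * (h + suc h) !                    ∎
    where
    open ≤-Reasoning
    lemma : ∀ x y z → 2 * x * ((y * z) * (y * z)) ≡ (y + y) * (y * (x * (z * z)))
    lemma = solve-∀

open Combinatorics

-- Supports of polynomials

monoEq⁻ : ∀ {k} (μ ν : Mono k) → T (monoEq μ ν) → ∀ i j → μ i j ≡ ν i j
monoEq⁻ μ ν t i j = ℕₚ.≡ᵇ⇒≡ _ _ (all-allFin⁻ _ (all-allFin⁻ _ t i) j)

monoEq⁺ : ∀ {k} (μ ν : Mono k) → (∀ i j → μ i j ≡ ν i j) → T (monoEq μ ν)
monoEq⁺ μ ν eq = all-allFin⁺ _ λ i → all-allFin⁺ _ λ j → ℕₚ.≡⇒≡ᵇ _ _ (eq i j)

-- The choice of one term of an affine form, where `nothing` is the constant term.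
Label : ℕ → Set
Label n = Maybe (Fin n × Fin n)

labelMono : ∀ {n} → Label n → Mono n
labelMono nothing        = zeroMono
labelMono (just (k , l)) = varMono k l

module Support {c ℓ₁ ℓ₂} (R : TotallyOrderedSemiring c ℓ₁ ℓ₂) where

  open TotallyOrderedSemiring R renaming (refl to ≈-refl; sym to ≈-sym; trans to ≈-trans) hiding (zero)
  open IsTotalOrder isTotalOrder using (total; antisym)
    renaming (reflexive to ≤R-reflexive; trans to ≤R-trans; refl to ≤R-refl)
  open Polynomials R
  open Exp semiring using (_^_; ^-congˡ; ^-homo-*)
  open CommutativeExp commutativeSemiring using (^-distrib-*)
  open Mult semiring using (×-assoc-*; ×-assocˡ; ×-congʳ) renaming (_×_ to _·_)
  open SetoidReasoning setoid

  ≤R-resp : ∀ {a b c d} → a ≈ c → b ≈ d → a ≤R b → c ≤R d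
  ≤R-resp p q r = ≤R-trans (≤R-reflexive (≈-sym p)) (≤R-trans r (≤R-reflexive q))

  Nil : Carrier → Set ℓ₁
  Nil x = ∃ λ k → x ^ k ≈ 0#

  nil-resp : ∀ {x y} → x ≈ y → Nil x → Nil y
  nil-resp x≈y (k , eq) = k , ≈-trans (^-congˡ k (≈-sym x≈y)) eq

  zero-nil : ∀ {x} → x ≈ 0# → Nil x
  zero-nil x≈0 = 1 , ≈-trans (*-congʳ x≈0) (zeroˡ _)

  nil-*ˡ : ∀ {x y} → Nil x → Nil (x * y)
  nil-*ˡ {x} {y} (k , eq) = k , ≈-trans (^-distrib-* x y k) (≈-trans (*-congʳ eq) (zeroˡ _))

  nil-*ʳ : ∀ {x y} → Nil y → Nil (x * y)
  nil-*ʳ nil = nil-resp (*-comm _ _) (nil-*ˡ nil)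

  -- The binomial theorem for nilpotents, without binomial coefficients: the factor c absorbs the powers
  -- already split off.
  annihilates-+ : ∀ x y i j c → c * x ^ i ≈ 0# → c * y ^ j ≈ 0# → c * (x + y) ^ (i ℕ.+ j) ≈ 0#
  annihilates-+ x y zero    j c p q = ≈-trans (*-congʳ (≈-trans (≈-sym (*-identityʳ c)) p)) (zeroˡ _)
  annihilates-+ x y (suc i) zero c p q = ≈-trans (*-congʳ (≈-trans (≈-sym (*-identityʳ c)) q)) (zeroˡ _)
  annihilates-+ x y (suc i) (suc j) c p q = begin
    c * ((x + y) * z)           ≈⟨ *-assoc c (x + y) z ⟨
    (c * (x + y)) * z           ≈⟨ *-congʳ (distribˡ c x y) ⟩
    (c * x + c * y) * z         ≈⟨ distribʳ z (c * x) (c * y) ⟩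
    (c * x) * z + (c * y) * z   ≈⟨ +-cong left right ⟩
    0# + 0#                     ≈⟨ +-identityˡ 0# ⟩
    0#                          ∎
    where
    z = (x + y) ^ (i ℕ.+ suc j)
    swap : ∀ a b → (c * a) * b ≈ (c * b) * a
    swap a b = ≈-trans (*-assoc c a b) (≈-trans (*-congˡ (*-comm a b)) (≈-sym (*-assoc c b a)))
    kill : ∀ {a b} → c * b ≈ 0# → (c * a) * b ≈ 0#
    kill eq = ≈-trans (swap _ _) (≈-trans (*-congʳ eq) (zeroˡ _))
    left : (c * x) * z ≈ 0#
    left = annihilates-+ x y i (suc j) (c * x) (≈-trans (*-assoc c x _) p) (kill q)
    right : (c * y) * z ≈ 0#
    right = ≈-trans (*-congˡ (reflexive (cong ((x + y) ^_) (ℕₚ.+-suc i j))))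
              (annihilates-+ x y (suc i) j (c * y) (kill p) (≈-trans (*-assoc c y _) q))

  nil-+ : ∀ {x y} → Nil x → Nil y → Nil (x + y)
  nil-+ {x} {y} (i , p) (j , q) = i ℕ.+ j , ≈-trans (≈-sym (*-identityˡ _))
    (annihilates-+ x y i j 1# (≈-trans (*-identityˡ _) p) (≈-trans (*-identityˡ _) q))

  1^≈1 : ∀ k → 1# ^ k ≈ 1#
  1^≈1 zero    = ≈-refl
  1^≈1 (suc k) = ≈-trans (*-identityˡ _) (1^≈1 k)

  1-not-nil : ¬ Nil 1#
  1-not-nil (k , eq) = 1≉0 (≈-trans (≈-sym (1^≈1 k)) eq)

  +-monoˡ : ∀ {a b} z → a ≤R b → (z + a) ≤R (z + b)
  +-monoˡ z a≤b = ≤R-resp (+-comm _ _) (+-comm _ _) (+-mono z a≤b)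

  -- Both signs of `1#` are possible. In either case the multiples of `1#` stay on its side of zero,
  -- and adding one more `1#` cannot lead back to zero.
  multiple-of-1≉0 : ∀ k → ¬ (suc k · 1# ≈ 0#)
  multiple-of-1≉0 k eq with total 0# 1#
  ... | inj₁ 0≤1 = 1≉0 (antisym (≤R-resp (+-identityʳ 1#) eq (+-monoˡ 1# (bound k))) 0≤1)
    where
    bound : ∀ k → 0# ≤R (k · 1#)
    bound zero    = ≤R-refl
    bound (suc k) = ≤R-trans (bound k) (≤R-resp (+-identityˡ _) ≈-refl (+-mono (k · 1#) 0≤1))
  ... | inj₂ 1≤0 = 1≉0 (antisym 1≤0 (≤R-resp eq (+-identityʳ 1#) (+-monoˡ 1# (bound k))))
    where
    bound : ∀ k → (k · 1#) ≤R 0#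
    bound zero    = ≤R-refl
    bound (suc k) = ≤R-trans (≤R-resp ≈-refl (+-identityˡ _) (+-mono (k · 1#) 1≤0)) (bound k)

  multiple-of-1-^ : ∀ k i → ∃ λ l → (suc k · 1#) ^ i ≈ suc l · 1#
  multiple-of-1-^ k zero    = 0 , ≈-sym (+-identityʳ 1#)
  multiple-of-1-^ k (suc i) =
    let l , eq = multiple-of-1-^ k i in
    l ℕ.+ k ℕ.* suc l , (begin
      (suc k · 1#) * (suc k · 1#) ^ i  ≈⟨ *-congˡ eq ⟩
      (suc k · 1#) * (suc l · 1#)      ≈⟨ ×-assoc-* (suc k) 1# (suc l · 1#) ⟩
      suc k · (1# * (suc l · 1#))      ≈⟨ ×-congʳ (suc k) (*-identityˡ (suc l · 1#)) ⟩
      suc k · (suc l · 1#)             ≈⟨ ×-assocˡ 1# (suc k) (suc l) ⟩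
      (suc k ℕ.* suc l) · 1#    ∎)

  multiple-of-1-not-nil : ∀ {x} k → x ≈ suc k · 1# → ¬ Nil x
  multiple-of-1-not-nil k x≈ nil =
    let i , eq = nil-resp x≈ nil ; l , eq′ = multiple-of-1-^ k i in
    multiple-of-1≉0 l (≈-trans (≈-sym eq′) eq)

  -- The nilpotents are closed under addition, so a coefficient that is not nilpotent needs a
  -- contributing term that is not. The double negation stands for deciding nilpotency term by term.
  coeff-nil : ∀ {k} (P : Poly k) μ →
    ¬ ¬ (Nil (coeff P μ) ⊎ ∃ λ x → ∃ λ ν → (x , ν) ∈ P × T (monoEq ν μ) × ¬ Nil x)
  coeff-nil [] μ K = K (inj₁ (zero-nil ≈-refl))
  coeff-nil ((a , ν) ∷ P) μ K = coeff-nil P μ λ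
    { (inj₂ (x , ξ , x∈ , eq , nn)) → K (inj₂ (x , ξ , there x∈ , eq , nn))
    ; (inj₁ nil) → head nil }
    where
    head : ¬ Nil (coeff P μ)
    head nil with monoEq ν μ in eq
    ... | false = K (inj₁ (nil-+ (zero-nil ≈-refl) nil))
    ... | true  = ¬¬-excluded-middle λ
      { (yes a-nil) → K (inj₁ (nil-+ a-nil nil))
      ; (no  a-nn)  → K (inj₂ (a , ν , here refl , subst T (sym eq) tt , a-nn)) }

  ∈-⊗⁻ : ∀ {k} (P Q : Poly k) {x ν} → (x , ν) ∈ P ⊗ Q →
    ∃ λ p → ∃ λ q → p ∈ P × q ∈ Q × x ≡ proj₁ p * proj₁ q × ν ≡ proj₂ p ⊕ proj₂ q
  ∈-⊗⁻ P Q x∈ with find (∈-concatMap⁻ _ {xs = P} x∈)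
  ... | (a , μ) , p∈ , x∈′ with ∈-map⁻ _ x∈′
  ...   | (b , ξ) , q∈ , refl = (a , μ) , (b , ξ) , p∈ , q∈ , refl , refl

  ∈-⊗⁺ : ∀ {k} {P Q : Poly k} {a μ b ξ} → (a , μ) ∈ P → (b , ξ) ∈ Q → (a * b , μ ⊕ ξ) ∈ P ⊗ Q
  ∈-⊗⁺ p∈ q∈ = ∈-concatMap⁺ _ (lose p∈ (∈-map⁺ _ q∈))

  Term : ℕ → Set c
  Term k = Carrier × Mono k

  -- The rest `Q` of the product is a parameter, so that `product-terms⁻` can peel off the matrix of
  -- factors row by row.
  factors⁻ : ∀ {k} m (G : Fin m → Poly k) Q {x ν} → (x , ν) ∈ foldr _⊗_ Q (tabulate G) → ¬ Nil x →
    ∃ λ (g : Fin m → Term k) → ∃ λ q → (∀ j → g j ∈ G j × ¬ Nil (proj₁ (g j))) × q ∈ Q × ¬ Nil (proj₁ q) ×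
      (∀ k l → ν k l ≡ sum (λ j → proj₂ (g j) k l) ℕ.+ proj₂ q k l)
  factors⁻ zero    G Q {x} {ν} x∈ nn = (λ ()) , (x , ν) , (λ ()) , x∈ , nn , λ _ _ → refl
  factors⁻ (suc m) G Q x∈ nn with ∈-⊗⁻ (G zero) (foldr _⊗_ Q (tabulate (G ∘ suc))) x∈
  ... | p , (y , ξ) , p∈ , y∈ , refl , refl with factors⁻ m (G ∘ suc) Q y∈ (nn ∘ nil-*ʳ)
  ...   | g , q , g∈ , q∈ , q-nn , eq =
    (λ { zero → p ; (suc j) → g j }) , q , (λ { zero → p∈ , nn ∘ nil-*ˡ ; (suc j) → g∈ j }) , q∈ , q-nn ,
    λ k l → trans (cong (proj₂ p k l ℕ.+_) (eq k l)) (sym (ℕₚ.+-assoc (proj₂ p k l) _ _))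

  product-terms⁻ : ∀ {k} a b (G : Fin a → Fin b → Poly k) {x ν} →
    (x , ν) ∈ foldr _⊗_ onePoly (concat (tabulate (λ i → tabulate (G i)))) → ¬ Nil x →
    ∃ λ (g : Fin a → Fin b → Term k) → (∀ i j → g i j ∈ G i j × ¬ Nil (proj₁ (g i j))) ×
      (∀ k l → ν k l ≡ sum (λ i → sum (λ j → proj₂ (g i j) k l)))
  product-terms⁻ zero    b G (here refl) nn = (λ ()) , (λ ()) , λ _ _ → refl
  product-terms⁻ (suc a) b G {x} {ν} x∈ nn
    with factors⁻ b (G zero) _ (subst ((x , ν) ∈_) (foldr-++ _⊗_ onePoly (tabulate (G zero)) _) x∈) nn
  ... | g₀ , q , g₀∈ , q∈ , q-nn , eq₀ with product-terms⁻ a b (G ∘ suc) q∈ q-nn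
  ...   | g , g∈ , eq = (λ { zero → g₀ ; (suc i) → g i }) , (λ { zero → g₀∈ ; (suc i) → g∈ i }) ,
    λ k l → trans (eq₀ k l) (cong (sum (λ j → proj₂ (g₀ j) k l) ℕ.+_) (eq k l))

  module _ {n m} (a₀ : Fin m → Fin m → Carrier) (a : Fin m → Fin m → Fin n → Fin n → Carrier) where

    labelCoeff : Fin m → Fin m → Label n → Carrier
    labelCoeff i j nothing        = a₀ i j
    labelCoeff i j (just (k , l)) = a i j k l

    entry : Fin m → Fin m → Poly n
    entry i j = affine (a₀ i j) (a i j)

    Supported : Fin m → Fin m → Label n → Set ℓ₁
    Supported i j c = ¬ Nil (labelCoeff i j c)

    labelsMono : (Fin m → Label n) → Mono n
    labelsMono lab k l = sum (λ i → labelMono (lab i) k l)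

    entry⁻ : ∀ i j {x ν} → (x , ν) ∈ entry i j → ∃ λ c → x ≡ labelCoeff i j c × ν ≡ labelMono c
    entry⁻ i j (here refl) = nothing , refl , refl
    entry⁻ i j (there x∈) with find (∈-concatMap⁻ _ {xs = allFin n} x∈)
    ... | k , _ , x∈′ with ∈-map⁻ _ x∈′
    ...   | l , _ , refl = just (k , l) , refl , refl

    entry⁺ : ∀ i j c → (labelCoeff i j c , labelMono c) ∈ entry i j
    entry⁺ i j nothing        = here refl
    entry⁺ i j (just (k , l)) = there (∈-concatMap⁺ _ (lose (∈-allFin k) (∈-map⁺ _ (∈-allFin l))))

    factor : (Fin m → Fin m) → Fin m → Fin m → Poly n
    factor π i j = entry i j ^P permMono π i j

    factor-on : ∀ π i → factor π i (π i) ≡ entry i (π i) ⊗ onePoly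
    factor-on π i rewrite dec-true (π i ≟ π i) refl = refl

    factor-off : ∀ π i j → j ≢ π i → factor π i j ≡ onePoly
    factor-off π i j j≢ rewrite dec-false (π i ≟ j) (j≢ ∘ sym) = refl

    expansion : (Fin m → Fin m) → Poly n
    expansion π = ((1# , zeroMono) ∷ []) ⊗ foldr _⊗_ onePoly (concat (tabulate (λ i → tabulate (factor π i))))

    expansion-≡ : ∀ π → ((1# , zeroMono) ∷ []) ⊗ foldr _⊗_ onePoly
      (concatMap (λ i → map (factor π i) (allFin m)) (allFin m)) ≡ expansion π
    expansion-≡ π = cong (λ Ps → ((1# , zeroMono) ∷ []) ⊗ foldr _⊗_ onePoly (concat Ps))
      (trans (map-cong (λ i → map-tabulate id (factor π i)) (allFin m)) (map-tabulate id (λ i → tabulate (factor π i))))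

    expansion⁻ : ∀ π {x ν} → (x , ν) ∈ expansion π → ¬ Nil x →
      ∃ λ lab → (∀ i → Supported i (π i) (lab i)) × (∀ k l → ν k l ≡ labelsMono lab k l)
    expansion⁻ π x∈ nn with ∈-⊗⁻ ((1# , zeroMono) ∷ []) _ x∈
    ... | _ , (y , ξ) , here refl , y∈ , refl , refl with product-terms⁻ m m (factor π) y∈ (nn ∘ nil-*ʳ)
    ...   | g , g∈ , eq = (λ i → proj₁ (label i)) , (λ i → proj₁ (proj₂ (label i))) , λ k l →
        trans (eq k l) (sum-cong-≗ λ i → trans (sum-pick _ (π i) (λ j j≢ → off i j j≢ k l)) (proj₂ (proj₂ (label i)) k l))
      where
      off : ∀ i j → j ≢ π i → ∀ k l → proj₂ (g i j) k l ≡ 0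
      off i j j≢ k l with subst (g i j ∈_) (factor-off π i j j≢) (proj₁ (g∈ i j))
      ... | here eq rewrite eq = refl
      label : ∀ i → ∃ λ c → Supported i (π i) c × (∀ k l → proj₂ (g i (π i)) k l ≡ labelMono c k l)
      label i with ∈-⊗⁻ (entry i (π i)) onePoly (subst (g i (π i) ∈_) (factor-on π i) (proj₁ (g∈ i (π i))))
      ... | p , _ , p∈ , here refl , eq₁ , eq₂ with entry⁻ i (π i) p∈
      ...   | c , refl , refl = c , (λ nil → proj₂ (g∈ i (π i)) (subst Nil (sym eq₁) (nil-*ˡ nil))) ,
              λ k l → trans (cong (λ ν → ν k l) eq₂) (ℕₚ.+-identityʳ _)

  -- A positive multiple of `1#` serves as well as `1#` itself, because it is not nilpotent either.
  HC-coeff-positive : ∀ {n} (ρs : List (Fin n → Fin n)) {ρ} μ → ρ ∈ ρs → T (monoEq (permMono ρ) μ) →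
    ∃ λ k → coeff (map (λ σ → (1# , permMono σ)) ρs) μ ≈ suc k · 1#
  HC-coeff-positive (σ ∷ ρs) μ ρ∈ t with monoEq (permMono σ) μ in eq
  ... | true  = let k , eq = multiple ρs in k , +-congˡ eq
    where
    multiple : ∀ ρs → ∃ λ k → coeff (map (λ σ → (1# , permMono σ)) ρs) μ ≈ k · 1#
    multiple []       = 0 , ≈-refl
    multiple (σ ∷ ρs) with multiple ρs | monoEq (permMono σ) μ
    ... | k , eq | true  = suc k , +-congˡ eq
    ... | k , eq | false = k , ≈-trans (+-identityˡ _) eq
  HC-coeff-positive (σ ∷ ρs) μ (here refl) t | false with subst T eq t
  ... | ()
  HC-coeff-positive (σ ∷ ρs) μ (there ρ∈) t | false =
    let k , eq = HC-coeff-positive ρs μ ρ∈ t in k , ≈-trans (+-identityˡ _) eq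

  HC-coeff-nonzero : ∀ {n} (ρs : List (Fin n → Fin n)) μ → ¬ (coeff (map (λ σ → (1# , permMono σ)) ρs) μ ≈ 0#) →
    ∃ λ ρ → ρ ∈ ρs × T (monoEq (permMono ρ) μ)
  HC-coeff-nonzero []       μ nz = contradiction ≈-refl nz
  HC-coeff-nonzero (σ ∷ ρs) μ nz with monoEq (permMono σ) μ in eq
  ... | true  = σ , here refl , subst T (sym eq) tt
  ... | false = let ρ , ρ∈ , t = HC-coeff-nonzero ρs μ (λ z → nz (≈-trans (+-identityˡ _) z)) in ρ , there ρ∈ , t

  module Positive (0≤1 : 0# ≤R 1#) where

    *-nonneg : ∀ {x y} → 0# ≤R x → 0# ≤R y → 0# ≤R (x * y)
    *-nonneg 0≤x 0≤y = ≤R-resp (zeroˡ _) ≈-refl (*-mono 0≤x 0≤y)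

    ^-nonneg : ∀ {x} k → 0# ≤R x → 0# ≤R (x ^ k)
    ^-nonneg zero    0≤x = 0≤1
    ^-nonneg (suc k) 0≤x = *-nonneg 0≤x (^-nonneg k 0≤x)

    ^-mono : ∀ {x y} k → 0# ≤R x → x ≤R y → (x ^ k) ≤R (y ^ k)
    ^-mono zero    0≤x x≤y = ≤R-refl
    ^-mono {x} {y} (suc k) 0≤x x≤y = ≤R-trans (*-mono x≤y (^-nonneg k 0≤x))
      (≤R-resp (*-comm _ _) (*-comm _ _) (*-mono (^-mono k 0≤x x≤y) (≤R-trans 0≤x x≤y)))

    -- From x ≤ y follows x x ≤ x y. Taking powers squeezes a power of x x between zero and zero.
    nil-smaller : ∀ {x y} → 0# ≤R x → x ≤R y → Nil (x * y) → Nil x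
    nil-smaller {x} {y} 0≤x x≤y (k , eq) = k ℕ.+ k , ≈-trans (^-homo-* x k k) (≈-trans (≈-sym (^-distrib-* x x k))
      (antisym (≤R-resp ≈-refl (≈-trans (^-congˡ k (*-comm y x)) eq) (^-mono k (*-nonneg 0≤x 0≤x) (*-mono x≤y 0≤x)))
        (^-nonneg k (*-nonneg 0≤x 0≤x))))

    -- On the nonnegative cone the nilpotents form a prime ideal, because the order is total.
    *-not-nil : ∀ {x y} → 0# ≤R x → 0# ≤R y → ¬ Nil x → ¬ Nil y → ¬ Nil (x * y)
    *-not-nil {x} {y} 0≤x 0≤y x-nn y-nn nil with total x y
    ... | inj₁ x≤y = x-nn (nil-smaller 0≤x x≤y nil)
    ... | inj₂ y≤x = y-nn (nil-smaller 0≤y y≤x (nil-resp (*-comm x y) nil))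

    Nonneg : ∀ {k} → Poly k → Set _
    Nonneg P = ∀ {x ν} → (x , ν) ∈ P → 0# ≤R x

    nonneg-one : ∀ {k} → Nonneg (onePoly {k})
    nonneg-one (here refl) = 0≤1

    nonneg-⊗ : ∀ {k} {P Q : Poly k} → Nonneg P → Nonneg Q → Nonneg (P ⊗ Q)
    nonneg-⊗ {P = P} {Q} P≥0 Q≥0 x∈ with ∈-⊗⁻ P Q x∈
    ... | p , q , p∈ , q∈ , refl , _ = *-nonneg (P≥0 p∈) (Q≥0 q∈)

    nonneg-^P : ∀ {k} {P : Poly k} e → Nonneg P → Nonneg (P ^P e)
    nonneg-^P zero    P≥0 = nonneg-one
    nonneg-^P (suc e) P≥0 = nonneg-⊗ P≥0 (nonneg-^P e P≥0)

    nonneg-product : ∀ {k} (Ps : List (Poly k)) → (∀ {P} → P ∈ Ps → Nonneg P) → Nonneg (foldr _⊗_ onePoly Ps)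
    nonneg-product []       h = nonneg-one
    nonneg-product (P ∷ Ps) h = nonneg-⊗ {P = P} (h (here refl)) (nonneg-product Ps (h ∘ there))

    coeff-nonneg : ∀ {k} (P : Poly k) μ → Nonneg P → 0# ≤R coeff P μ
    coeff-nonneg [] μ h = ≤R-refl
    coeff-nonneg ((b , ν) ∷ P) μ h with monoEq ν μ
    ... | true  = ≤R-trans (coeff-nonneg P μ (h ∘ there)) (≤R-resp (+-identityˡ _) ≈-refl (+-mono _ (h (here refl))))
    ... | false = ≤R-resp ≈-refl (≈-sym (+-identityˡ _)) (coeff-nonneg P μ (h ∘ there))

    -- Nonnegative terms cannot cancel, so a single term survives in the coefficient.
    term≤coeff : ∀ {k} (P : Poly k) μ → Nonneg P → ∀ {x ν} → (x , ν) ∈ P → T (monoEq ν μ) → x ≤R coeff P μ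
    term≤coeff ((b , ν) ∷ P) μ h (here refl) t with monoEq ν μ
    ... | true  = ≤R-resp (+-identityʳ _) ≈-refl (+-monoˡ b (coeff-nonneg P μ (h ∘ there)))
    term≤coeff ((b , ν) ∷ P) μ h (there x∈) t with monoEq ν μ
    ... | true  = ≤R-trans (term≤coeff P μ (h ∘ there) x∈ t) (≤R-resp (+-identityˡ _) ≈-refl (+-mono _ (h (here refl))))
    ... | false = ≤R-resp ≈-refl (≈-sym (+-identityˡ _)) (term≤coeff P μ (h ∘ there) x∈ t)

    Good : Carrier → Set _
    Good x = 0# ≤R x × ¬ Nil x

    good-* : ∀ {x y} → Good x → Good y → Good (x * y)
    good-* (x≥0 , x-nn) (y≥0 , y-nn) = *-nonneg x≥0 y≥0 , *-not-nil x≥0 y≥0 x-nn y-nn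

    factors⁺ : ∀ {k} m (G : Fin m → Poly k) Q (g : Fin m → Term k) q → (∀ j → g j ∈ G j × Good (proj₁ (g j))) →
      q ∈ Q → Good (proj₁ q) → ∃ λ p → p ∈ foldr _⊗_ Q (tabulate G) × Good (proj₁ p) ×
        (∀ k l → proj₂ p k l ≡ sum (λ j → proj₂ (g j) k l) ℕ.+ proj₂ q k l)
    factors⁺ zero    G Q g q h q∈ q-good = q , q∈ , q-good , λ _ _ → refl
    factors⁺ (suc m) G Q g q h q∈ q-good =
      let p , p∈ , p-good , eq = factors⁺ m (G ∘ suc) Q (g ∘ suc) q (h ∘ suc) q∈ q-good in
      _ , ∈-⊗⁺ (proj₁ (h zero)) p∈ , good-* (proj₂ (h zero)) p-good ,
      λ k l → trans (cong (proj₂ (g zero) k l ℕ.+_) (eq k l)) (sym (ℕₚ.+-assoc (proj₂ (g zero) k l) _ _))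

    product-terms⁺ : ∀ {k} a b (G : Fin a → Fin b → Poly k) (g : Fin a → Fin b → Term k) →
      (∀ i j → g i j ∈ G i j × Good (proj₁ (g i j))) →
      ∃ λ p → p ∈ foldr _⊗_ onePoly (concat (tabulate (λ i → tabulate (G i)))) × Good (proj₁ p) ×
        (∀ k l → proj₂ p k l ≡ sum (λ i → sum (λ j → proj₂ (g i j) k l)))
    product-terms⁺ zero    b G g h = _ , here refl , (0≤1 , 1-not-nil) , λ _ _ → refl
    product-terms⁺ (suc a) b G g h =
      let q , q∈ , q-good , eq = product-terms⁺ a b (G ∘ suc) (g ∘ suc) (h ∘ suc)
          p , p∈ , p-good , eq′ = factors⁺ b (G zero) _ (g zero) q (h zero) q∈ q-good
      in p , subst (p ∈_) (sym (foldr-++ _⊗_ onePoly (tabulate (G zero)) _)) p∈ , p-good ,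
         λ k l → trans (eq′ k l) (cong (sum (λ j → proj₂ (g zero j) k l) ℕ.+_) (eq k l))

    expansion⁺ : ∀ {n m} (a₀ : Fin m → Fin m → Carrier) (a : Fin m → Fin m → Fin n → Fin n → Carrier) →
      (∀ i j c → 0# ≤R labelCoeff a₀ a i j c) → ∀ π lab → (∀ i → Supported a₀ a i (π i) (lab i)) →
      ∃ λ p → p ∈ expansion a₀ a π × Good (proj₁ p) × (∀ k l → proj₂ p k l ≡ labelsMono a₀ a lab k l)
    expansion⁺ {n} {m} a₀ a a≥0 π lab sup =
      let p , p∈ , p-good , eq = product-terms⁺ m m (factor a₀ a π) g g-good in
      _ , ∈-⊗⁺ {P = (1# , zeroMono) ∷ []} (here refl) p∈ , good-* (0≤1 , 1-not-nil) p-good ,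
      λ k l → trans (eq k l) (sum-cong-≗ λ i → trans (sum-pick _ (π i) (λ j j≢ → off i j j≢ k l)) (on i k l))
      where
      g : Fin m → Fin m → Term n
      g i j = if does (j ≟ π i) then (labelCoeff a₀ a i j (lab i) * 1# , labelMono (lab i) ⊕ zeroMono) else (1# , zeroMono)
      g-good : ∀ i j → g i j ∈ factor a₀ a π i j × Good (proj₁ (g i j))
      g-good i j with j ≟ π i
      ... | yes refl = subst ((labelCoeff a₀ a i (π i) (lab i) * 1# , labelMono (lab i) ⊕ zeroMono) ∈_)
                         (sym (factor-on a₀ a π i)) (∈-⊗⁺ {Q = onePoly} (entry⁺ a₀ a i (π i) (lab i)) (here refl)) ,
                       *-nonneg (a≥0 i (π i) (lab i)) 0≤1 , *-not-nil (a≥0 i (π i) (lab i)) 0≤1 (sup i) 1-not-nil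
      ... | no  j≢   = subst (_ ∈_) (sym (factor-off a₀ a π i j j≢)) (here refl) , 0≤1 , 1-not-nil
      off : ∀ i j → j ≢ π i → ∀ k l → proj₂ (g i j) k l ≡ 0
      off i j j≢ k l rewrite dec-false (j ≟ π i) j≢ = refl
      on : ∀ i k l → proj₂ (g i (π i)) k l ≡ labelMono (lab i) k l
      on i k l rewrite dec-true (π i ≟ π i) refl = ℕₚ.+-identityʳ _

  -- Correspondence between supported matchings and n-cycles.

  module Projection {n m} (proj : IsMonotoneAffineProjection (HC n) (perm m)) where

    a₀ = proj₁ proj
    a  = proj₁ (proj₂ proj)

    coeff-≈ : substitute (entry a₀ a) (perm m) ≈P HC n
    coeff-≈ = proj₂ (proj₂ (proj₂ (proj₂ proj)))

    nonneg : ∀ i j c → 0# ≤R labelCoeff a₀ a i j c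
    nonneg i j nothing        = proj₁ (proj₂ (proj₂ proj)) i j
    nonneg i j (just (k , l)) = proj₁ (proj₂ (proj₂ (proj₂ proj))) i j k l

    Edge : Fin m → Fin m → Label n → Set ℓ₁
    Edge = Supported a₀ a

    monoOf : (Fin m → Label n) → Mono n
    monoOf = labelsMono a₀ a

    ∈-substitute⁻ : ∀ {p} → p ∈ substitute (entry a₀ a) (perm m) →
      ∃ λ π → Injective _≡_ _≡_ π × p ∈ expansion a₀ a π
    ∈-substitute⁻ {p} p∈ with find (∈-concatMap⁻ _ {xs = perm m} p∈)
    ... | q , q∈ , p∈′ with ∈-map⁻ (λ σ → (1# , permMono σ)) {xs = permutations m} q∈
    ...   | π , π∈ , refl = π , permutations-sound π∈ , subst (p ∈_) (expansion-≡ a₀ a π) p∈′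

    ∈-substitute⁺ : ∀ {p π} → π ∈ permutations m → p ∈ expansion a₀ a π → p ∈ substitute (entry a₀ a) (perm m)
    ∈-substitute⁺ {p} {π} π∈ p∈ = ∈-concatMap⁺ _
      (lose (∈-map⁺ (λ σ → (1# , permMono σ)) π∈) (subst (p ∈_) (sym (expansion-≡ a₀ a π)) p∈))

    -- The coefficient of `σ` in `HC n` is not nilpotent, hence neither is some term of the
    -- substituted permanent, and then none of the factors of that term is.
    matching-of : ∀ σ → Cyclic σ → ¬ ¬ (∃ λ π → ∃ λ lab → Injective _≡_ _≡_ π ×
      (∀ i → Edge i (π i) (lab i)) × (∀ k l → monoOf lab k l ≡ permMono σ k l))
    matching-of σ cyc K with nCycles-complete σ cyc
    ... | ρ , ρ∈ , ρ≗σ with HC-coeff-positive (nCycles n) (permMono σ) ρ∈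
                             (monoEq⁺ _ _ λ i j → cong (λ x → if x == j then 1 else 0) (ρ≗σ i))
    ...   | k , eq = coeff-nil (substitute (entry a₀ a) (perm m)) (permMono σ) λ
      { (inj₁ nil) → multiple-of-1-not-nil k (≈-trans (coeff-≈ (permMono σ)) eq) nil
      ; (inj₂ (x , ν , x∈ , t , nn)) →
          let π , π-inj , x∈′ = ∈-substitute⁻ x∈
              lab , sup , mono = expansion⁻ a₀ a π x∈′ nn
          in K (π , lab , π-inj , sup , λ k l → trans (sym (mono k l)) (monoEq⁻ ν (permMono σ) t k l)) }

    -- If 1 ≤ 0, multiplying by a nonnegative element shows that it is zero, and then no label is
    -- supported.
    supported⇒0≤1 : ∀ i j c → Edge i j c → 0# ≤R 1#
    supported⇒0≤1 i j c nn with total 0# 1#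
    ... | inj₁ 0≤1 = 0≤1
    ... | inj₂ 1≤0 = contradiction (zero-nil (antisym
            (≤R-resp (*-identityˡ _) (zeroˡ _) (*-mono 1≤0 (nonneg i j c))) (nonneg i j c))) nn

    -- The product of supported coefficients is nonnegative and not nilpotent, so it bounds the
    -- coefficient of its monomial away from zero; that monomial therefore occurs in `HC n`.
    cycle-of : 0# ≤R 1# → ∀ π lab → Injective _≡_ _≡_ π → (∀ i → Edge i (π i) (lab i)) →
      ∃ λ σ → Cyclic σ × (∀ k l → monoOf lab k l ≡ permMono σ k l)
    cycle-of 0≤1 π lab π-inj edges with permutations-complete π π-inj
    ... | π′ , π′∈ , π′≗π with expansion⁺ a₀ a nonneg π′ lab (λ i → subst (λ j → Edge i j (lab i)) (sym (π′≗π i)) (edges i))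
      where open Positive 0≤1
    ...   | (x , ν) , x∈ , (x≥0 , x-nn) , eq =
      let σ , σ∈ , t = HC-coeff-nonzero (nCycles n) ν nonzero in
      σ , nCycles-sound σ∈ , λ k l → trans (sym (eq k l)) (sym (monoEq⁻ (permMono σ) ν t k l))
      where
      open Positive 0≤1
      S = substitute (entry a₀ a) (perm m)
      entry≥0 : ∀ i j → Nonneg (entry a₀ a i j)
      entry≥0 i j p∈ with entry⁻ a₀ a i j p∈
      ... | c , refl , _ = nonneg i j c
      factors≥0 : ∀ τ {P} → P ∈ concatMap (λ i → map (factor a₀ a τ i) (allFin m)) (allFin m) → Nonneg P
      factors≥0 τ P∈ with find (∈-concatMap⁻ _ {xs = allFin m} P∈)
      ... | i , _ , P∈′ with ∈-map⁻ (factor a₀ a τ i) P∈′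
      ...   | j , _ , refl = nonneg-^P (permMono τ i j) (entry≥0 i j)
      expansion≥0 : ∀ τ → Nonneg (expansion a₀ a τ)
      expansion≥0 τ = subst Nonneg (expansion-≡ a₀ a τ)
        (nonneg-⊗ {P = (1# , zeroMono) ∷ []} (λ { (here refl) → 0≤1 }) (nonneg-product _ (factors≥0 τ)))
      S≥0 : Nonneg S
      S≥0 p∈ = let τ , _ , p∈′ = ∈-substitute⁻ p∈ in expansion≥0 τ p∈′
      nonzero : ¬ (coeff (HC n) ν ≈ 0#)
      nonzero c≈0 = x-nn (zero-nil (antisym
        (≤R-resp ≈-refl (≈-trans (coeff-≈ ν) c≈0)
          (term≤coeff S ν S≥0 (∈-substitute⁺ π′∈ x∈) (monoEq⁺ ν ν λ _ _ → refl))) x≥0))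

open import Data.Nat using (_≤_; _<_; _+_; _*_; _∸_; _^_; _≡ᵇ_; _!; z≤n; s≤s; _/_; _%_)
open import Data.Nat.DivMod using (m≡m%n+[m/n]*n; m%n<n)
open import Data.Nat.Properties hiding (_≟_)

-- Alternating walks of a projection

iter-injective : ∀ {n} (f : Fin n → Fin n) → Injective _≡_ _≡_ f → ∀ k → Injective _≡_ _≡_ (iter f k)
iter-injective f inj zero    eq = eq
iter-injective f inj (suc k) eq = iter-injective f inj k (inj eq)

returns : ∀ {n} (f : Fin n → Fin n) → Injective _≡_ _≡_ f → ∀ u → ∃ λ k → iter f k (f u) ≡ u
returns {n} f inj u with pigeonhole (n<1+n n) (λ i → iter f (toℕ i) u)
... | i , j , i<j , eq = toℕ j ∸ suc (toℕ i) , iter-injective f inj (toℕ i) (begin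
  iter f (toℕ i) (iter f d (f u))       ≡⟨ cong (iter f (toℕ i)) (iter-shift f d u) ⟩
  iter f (toℕ i) (iter f (suc d) u)     ≡⟨ iter-+ f (toℕ i) (suc d) u ⟨
  iter f (toℕ i + suc d) u              ≡⟨ cong (λ k → iter f k u) (trans (+-suc (toℕ i) d) (m+[n∸m]≡n i<j)) ⟩
  iter f (toℕ j) u                      ≡⟨ eq ⟨
  iter f (toℕ i) u                      ∎)
  where
  open ≡-Reasoning
  d = toℕ j ∸ suc (toℕ i)

-- Lets all orderings be given their data under one double negation before they are counted.
¬¬-All : ∀ {a p} {A : Set a} {P : A → Set p} (xs : List A) → (∀ {x} → x ∈ xs → ¬ ¬ P x) → ¬ ¬ All P xs
¬¬-All []       h K = K []
¬¬-All (x ∷ xs) h K = h (here refl) λ px → ¬¬-All xs (h ∘ there) λ pxs → K (px ∷ pxs)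

labelMono-self : ∀ {n} (k l : Fin n) → labelMono (just (k , l)) k l ≡ 1
labelMono-self k l rewrite dec-true (k ≟ k) refl | dec-true (l ≟ l) refl = refl

labelMono-off : ∀ {n} (c : Label n) k l → 0 < labelMono c k l → c ≡ just (k , l)
labelMono-off (just (a , b)) k l 0<c with a ≟ k | b ≟ l
... | yes refl | yes refl = refl

label-decomposition : ∀ {n} (w : Label n → ℕ) → w nothing ≡ 0 → ∀ c →
  w c ≡ sum (λ k → sum (λ l → labelMono c k l * w (just (k , l))))
label-decomposition w w₀ nothing = trans w₀ (sym (sum-zero λ k → sum-zero {g = λ l → 0 * w (just (k , l))} λ l → refl))
label-decomposition w w₀ (just (a , b)) = sym (begin
  sum (λ k → sum (λ l → labelMono c k l * w (just (k , l))))
    ≡⟨ sum-pick _ a (λ k k≢ → sum-zero λ l → cong (_* w (just (k , l))) (off k l (k≢ ∘ cong proj₁))) ⟩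
  sum (λ l → labelMono c a l * w (just (a , l)))
    ≡⟨ sum-pick _ b (λ l l≢ → cong (_* w (just (a , l))) (off a l (l≢ ∘ cong proj₂))) ⟩
  labelMono c a b * w c
    ≡⟨ cong (_* w c) (labelMono-self a b) ⟩
  1 * w c
    ≡⟨ *-identityˡ (w c) ⟩
  w c ∎)
  where
  open ≡-Reasoning
  c = just (a , b)
  off : ∀ k l → (k , l) ≢ (a , b) → labelMono c k l ≡ 0
  off k l ≢ab with labelMono c k l in eq
  ... | zero  = refl
  ... | suc _ with labelMono-off c k l (subst (0 <_) (sym eq) (s≤s z≤n))
  ...   | refl = contradiction refl ≢ab

permMono-on : ∀ {n} (σ : Fin n → Fin n) k → permMono σ k (σ k) ≡ 1
permMono-on σ k rewrite dec-true (σ k ≟ σ k) refl = refl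

permMono-positive : ∀ {n} (σ : Fin n → Fin n) k l → 0 < permMono σ k l → l ≡ σ k
permMono-positive σ k l p with σ k ≟ l
... | yes eq = sym eq

-- A weight that vanishes on `nothing` is linear in the label monomials, so its total depends only
-- on their product.
sum-labels : ∀ {n m} (w : Label n → ℕ) → w nothing ≡ 0 → (lab : Fin m → Label n) (σ : Fin n → Fin n) →
  (∀ k l → sum (λ i → labelMono (lab i) k l) ≡ permMono σ k l) →
  sum (w ∘ lab) ≡ sum (λ k → w (just (k , σ k)))
sum-labels w w₀ lab σ mono = begin
  sum (w ∘ lab)
    ≡⟨ sum-cong-≗ (λ i → label-decomposition w w₀ (lab i)) ⟩
  sum (λ i → sum (λ k → sum (λ l → labelMono (lab i) k l * w (just (k , l)))))
    ≡⟨ ∑-comm (λ i k → sum (λ l → labelMono (lab i) k l * w (just (k , l)))) ⟩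
  sum (λ k → sum (λ i → sum (λ l → labelMono (lab i) k l * w (just (k , l)))))
    ≡⟨ sum-cong-≗ (λ k → ∑-comm (λ i l → labelMono (lab i) k l * w (just (k , l)))) ⟩
  sum (λ k → sum (λ l → sum (λ i → labelMono (lab i) k l * w (just (k , l)))))
    ≡⟨ sum-cong-≗ (λ k → sum-cong-≗ (λ l → *-distribʳ-sum (w (just (k , l))) (λ i → labelMono (lab i) k l))) ⟨
  sum (λ k → sum (λ l → sum (λ i → labelMono (lab i) k l) * w (just (k , l))))
    ≡⟨ sum-cong-≗ (λ k → sum-cong-≗ (λ l → cong (_* w (just (k , l))) (mono k l))) ⟩
  sum (λ k → sum (λ l → permMono σ k l * w (just (k , l))))
    ≡⟨ sum-cong-≗ (λ k → sum-pick _ (σ k) (λ l l≢ → cong (_* w (just (k , l))) (off k l l≢))) ⟩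
  sum (λ k → permMono σ k (σ k) * w (just (k , σ k)))
    ≡⟨ sum-cong-≗ (λ k → trans (cong (_* w (just (k , σ k))) (permMono-on σ k)) (*-identityˡ _)) ⟩
  sum (λ k → w (just (k , σ k))) ∎
  where
  open ≡-Reasoning
  off : ∀ k l → l ≢ σ k → permMono σ k l ≡ 0
  off k l l≢ rewrite dec-false (σ k ≟ l) (l≢ ∘ sym) = refl

module _ {c ℓ₁ ℓ₂} (R : TotallyOrderedSemiring c ℓ₁ ℓ₂) (r h′ m : ℕ) where

  -- This choice makes `N` equal to `h + h` by computation, with `h` = `suc h′` positive.
  open Gadgets r (h′ + suc h′)
  open TotallyOrderedSemiring R using (_≤R_; 0#; 1#)
  open Polynomials R using (IsMonotoneAffineProjection; HC; perm)

  h : ℕ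
  h = suc h′

  module LowerBound (proj : IsMonotoneAffineProjection (HC n) (perm m)) where

    open Support R using (module Projection)
    open Projection proj

    -- The jump back to the pads; it is the reference with which all other rows and columns are
    -- compared.
    star : Lab → ℕ
    star = colW zero

    OnArc : Lab → Set
    OnArc nothing        = ⊤
    OnArc (just (k , l)) = IsArc k l

    HasMono : (Fin m → Lab) → (Fin n → Fin n) → Set
    HasMono lab σ = ∀ k l → monoOf lab k l ≡ permMono σ k l

    label-on-cycle : ∀ lab σ → HasMono lab σ → ∀ i {k l} → lab i ≡ just (k , l) → l ≡ σ k
    label-on-cycle lab σ mono i {k} {l} eq = permMono-positive σ k l (subst (0 <_) (mono k l)
      (≤-trans (≤-reflexive (sym (trans (cong (λ c → labelMono c k l) eq) (labelMono-self k l)))) (≤-sum _ i)))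

    label-of : ∀ lab σ → HasMono lab σ → ∀ k → ∃ λ i → lab i ≡ just (k , σ k)
    label-of lab σ mono k with sum-positive (λ i → labelMono (lab i) k (σ k))
                                     (subst (0 <_) (sym (trans (mono k (σ k)) (permMono-on σ k))) (s≤s z≤n))
    ... | i , 0<c = i , labelMono-off (lab i) k (σ k) 0<c

    labels-on-arcs : ∀ lab σ → HasMono lab σ → Respects σ → ∀ i → OnArc (lab i)
    labels-on-arcs lab σ mono resp i with lab i in eq
    ... | nothing      = tt
    ... | just (k , l) = subst (IsArc k) (sym (label-on-cycle lab σ mono i eq)) (resp k)

    -- The columns are reindexed so that the matching π₀ of the backward tour becomes the identity.
    module Relative (0≤1 : 0# ≤R 1#) (π₀ : Fin m → Fin m) (lab₀ : Fin m → Lab) (π₀-injective : Injective _≡_ _≡_ π₀)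
      (edge₀ : ∀ i → Edge i (π₀ i) (lab₀ i)) (arc₀ : ∀ i → OnArc (lab₀ i))
      (row₀ : ∀ a i → rowW a (lab₀ i) ≡ 0) (col₀ : ∀ b i → colW b (lab₀ i) ≡ 0) where

      E : Fin m → Fin m → Lab → Set _
      E i j c = Edge i (π₀ j) c × OnArc c

      open Walks E

      matching-balanced : ∀ π lab → Injective _≡_ _≡_ π → (∀ i → E i (π i) (lab i)) →
        ∃ λ ε → (∀ a → sum (rowW a ∘ lab) ≡ ε) × (∀ b → sum (colW b ∘ lab) ≡ ε)
      matching-balanced π lab inj es =
        let σ , cyc , mono = cycle-of 0≤1 (π₀ ∘ π) lab (inj ∘ π₀-injective) (proj₁ ∘ es)
            ε , rows , cols = cycle-balanced σ cyc λ k →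
              let i , eq = label-of lab σ mono k in subst OnArc eq (proj₂ (es i))
        in ε , (λ a → trans (sum-labels (rowW a) refl lab σ mono) (rows a)) ,
               (λ b → trans (sum-labels (colW b) refl lab σ mono) (cols b))

      e₀ : ∀ i → E i i (lab₀ i)
      e₀ i = edge₀ i , arc₀ i

      closed-row : ∀ a {x} (w : Walk x x) → weight (rowW a) w ≡ weight star w
      closed-row a = LoopErasure.closed-walk-balanced E lab₀ e₀ (rowW a) star (row₀ a) (col₀ zero)
        λ π lab inj es → let _ , rows , cols = matching-balanced π lab inj es in trans (rows a) (sym (cols zero))

      closed-col : ∀ b {x} (w : Walk x x) → weight (colW b) w ≡ weight star w
      closed-col b = LoopErasure.closed-walk-balanced E lab₀ e₀ (colW b) star (col₀ b) (col₀ zero)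
        λ π lab inj es → let _ , _ , cols = matching-balanced π lab inj es in trans (cols b) (sym (cols zero))

      stop : Lab → ℕ
      stop c = sum (λ b → colW (suc b) c)

      isOut≤1 : ∀ x → isOut x ≤ 1
      isOut≤1 (pad k) with does (k ≟ Data.Fin.fromℕ r)
      ... | true  = ≤-refl
      ... | false = z≤n
      isOut≤1 (u _) = z≤n
      isOut≤1 (v _) = z≤n
      isOut≤1 (t _) = ≤-refl

      stop≤1 : ∀ c → stop c ≤ 1
      stop≤1 nothing = ≤-trans (≤-reflexive (sum-zero {N} λ _ → refl)) z≤n
      stop≤1 (just (k , l)) with any? (λ b → l ≟ enc (inn (suc b)))
      ... | yes (b , refl) = ≤-trans (≤-reflexive (sum-pick (λ b′ → colW (suc b′) (just (k , l))) b off)) on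
        where
        u-injective : ∀ {i j} → u i ≡ u j → j ≡ i
        u-injective refl = refl
        off : ∀ b′ → b′ ≢ b → colW (suc b′) (just (k , l)) ≡ 0
        off b′ b′≢ rewrite dec-false (enc (u b) ≟ enc (u b′)) (λ eq → b′≢ (u-injective (enc-injective eq))) = refl
        on : colW (suc b) (just (k , l)) ≤ 1
        on rewrite dec-true (enc (u b) ≟ enc (u b)) refl = isOut≤1 (dec k)
      ... | no  none = ≤-trans (≤-reflexive (sum-zero off)) z≤n
        where
        off : ∀ b → colW (suc b) (just (k , l)) ≡ 0
        off b rewrite dec-false (l ≟ enc (u b)) (λ eq → none (b , eq)) = refl

      -- The star is the jump that closes the tour, so the prefix contains it and h jumps into gadgets remain.
      record Split (ys : List (Fin N)) : Set ℓ₁ where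
        constructor split
        field
          start middle : Fin m
          prefix : Walk start middle
          suffix : Walk middle start
          star-prefix : weight star prefix ≡ 1
          star-suffix : weight star suffix ≡ 0
          stop-suffix : weight stop suffix ≡ h
          -- The ordering maps the jump sources of the suffix to its jump targets.
          linked : Along (λ a x → weight (rowW a) suffix ≡ weight (colW (suc x)) suffix) suc zero ys

        I J : Fin (suc N) → ℕ
        I a = weight (rowW a) suffix
        J b = weight (colW b) suffix

      open Split using (start; middle; prefix; suffix; I; J)

      col-total : ∀ {x y} (p : Walk x y) (q : Walk y x) → weight star p ≡ 1 → weight star q ≡ 0 →
        ∀ b → weight (colW b) p + weight (colW b) q ≡ 1
      col-total p q p₁ q₀ b = trans (sym (weight-⁀ (colW b) p q)) (trans (closed-col b (p ⁀ q))
        (trans (weight-⁀ star p q) (cong₂ _+_ p₁ q₀)))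

      row-total : ∀ {x y} (p : Walk x y) (q : Walk y x) → weight star p ≡ 1 → weight star q ≡ 0 →
        ∀ a → weight (rowW a) p + weight (rowW a) q ≡ 1
      row-total p q p₁ q₀ a = trans (sym (weight-⁀ (rowW a) p q)) (trans (closed-row a (p ⁀ q))
        (trans (weight-⁀ star p q) (cong₂ _+_ p₁ q₀)))

      -- The prefix of one walk closes up with the suffix of any other walk having the same end points.
      same-class : ∀ {ys zs} (d : Split ys) (d′ : Split zs) → start d ≡ start d′ → middle d ≡ middle d′ →
        (∀ a → I d′ a ≡ I d a) × (∀ b → J d′ b ≡ J d b)
      same-class (split _ _ p q p₁ q₀ _ _) (split _ _ _ q′ _ q₀′ _ _) refl refl =
        (λ a → +-cancelˡ-≡ (weight (rowW a) p) _ _ (trans (row-total p q′ p₁ q₀′ a) (sym (row-total p q p₁ q₀ a)))) ,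
        (λ b → +-cancelˡ-≡ (weight (colW b) p) _ _ (trans (col-total p q′ p₁ q₀′ b) (sym (col-total p q p₁ q₀ b))))

      J≤1 : ∀ {ys} (d : Split ys) b → J d b ≤ 1
      J≤1 (split _ _ p q p₁ q₀ _ _) b = ≤-trans (m≤n+m _ _) (≤-reflexive (col-total p q p₁ q₀ b))

      Ib : ∀ {ys} → Split ys → Fin (suc N) → Bool
      Ib d a = I d a ≡ᵇ 1

      Jb : ∀ {ys} → Split ys → Fin N → Bool
      Jb d x = J d (suc x) ≡ᵇ 1

      compatible : ∀ {ys} → Split ys → List (Fin N) → Bool
      compatible d = consistent (Ib d ∘ suc) (Jb d) (Ib d zero)

      along⇒compatible : ∀ {ys} (d : Split ys) a zs → Along (λ a x → I d a ≡ J d (suc x)) suc a zs →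
        T (consistent (Ib d ∘ suc) (Jb d) (Ib d a) zs)
      along⇒compatible d a []       _        = tt
      along⇒compatible d a (x ∷ zs) (eq , c) = Equivalence.from T-∧ (same , along⇒compatible d (suc x) zs c)
        where
        agree-refl : ∀ b → T (agree b b)
        agree-refl true  = tt
        agree-refl false = tt
        same : T (agree (Jb d x) (Ib d a))
        same = subst (λ k → T (agree (Jb d x) (k ≡ᵇ 1))) (sym eq) (agree-refl (Jb d x))

      -- All orderings of a class are tested against the sets of one representative `d`, which is
      -- the form that `count-consistent` needs.
      class-compatible : ∀ {ys zs} (d : Split ys) (d′ : Split zs) → start d ≡ start d′ → middle d ≡ middle d′ →
        T (compatible d zs)
      class-compatible {zs = zs} d d′ eq eq′ =
        let I≡ , J≡ = same-class d d′ eq eq′ in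
        along⇒compatible d zero zs
          (along-map (λ {a} {x} e → trans (sym (I≡ a)) (trans e (J≡ (suc x)))) zero zs (Split.linked d′))

      vcount-Jb : ∀ {ys} (d : Split ys) → vcount (Jb d) (Vec.allFin N) ≡ h
      vcount-Jb d = trans (vcount-tabulate (Jb d) id) (trans (sum-cong-≗ λ x → bit (J≤1 d (suc x)))
        (trans (sym (weight-sum (λ b → colW (suc b)) (suffix d))) (Split.stop-suffix d)))
        where
        bit : ∀ {k} → k ≤ 1 → 𝟙 (k ≡ᵇ 1) ≡ k
        bit z≤n       = refl
        bit (s≤s z≤n) = refl

      vcount-notJb : ∀ {ys} (d : Split ys) → vcount (not ∘ Jb d) (Vec.allFin N) ≡ h
      vcount-notJb d = +-cancelˡ-≡ h _ _
        (trans (cong (_+ vcount (not ∘ Jb d) (Vec.allFin N)) (sym (vcount-Jb d))) (vcount-complement (Jb d) (Vec.allFin N)))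

      weight-zero : ∀ {f x y} {w : Walk x y} → AllSteps (λ c → f c ≡ 0) w → weight f w ≡ 0
      weight-zero nil         = refl
      weight-zero (step p ps) = cong₂ _+_ p (weight-zero ps)

      -- By injectivity the arc from `out a` is also the only one of the cycle that enters
      -- `inn (suc x)`, so both weights are 1 on its label and 0 on all others.
      row≡col : ∀ lab σ → HasMono lab σ → Injective _≡_ _≡_ σ → ∀ {a x} → σ (enc (out a)) ≡ enc (inn (suc x)) →
        ∀ i → rowW a (lab i) ≡ colW (suc x) (lab i)
      row≡col lab σ mono inj {a} {x} σa i with lab i in eq
      ... | nothing = refl
      ... | just (k , l) with label-on-cycle lab σ mono i eq
      ...   | refl with k ≟ enc (out a)
      ...     | yes refl rewrite σa | dec-true (enc (u x) ≟ enc (u x)) refl | dec-enc (u x) | dec-enc (out a) =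
                sym (isOut-out a)
      ...     | no  k≢ rewrite dec-false (σ k ≟ enc (u x)) (λ eq → k≢ (inj (trans eq (sym σa)))) = refl

      module _ (σ : Fin n → Fin n) (cyc : Cyclic σ) (resp : Respects σ) (ys : List (Fin N)) (len : length ys ≡ N)
        (visits : Visits σ zero ys) (π : Fin m → Fin m) (lab : Fin m → Lab) (π-injective : Injective _≡_ _≡_ π)
        (edges : ∀ i → Edge i (π i) (lab i)) (mono : HasMono lab σ) where

        pre : ∀ y → ∃ λ x → π₀ x ≡ y
        pre = injective⇒surjective π₀ π₀-injective ≤-refl

        next-vertex : Fin m → Fin m
        next-vertex i = proj₁ (pre (π i))

        next-injective : Injective _≡_ _≡_ next-vertex
        next-injective {x} {y} eq = π-injective (trans (sym (proj₂ (pre (π x)))) (trans (cong π₀ eq) (proj₂ (pre (π y)))))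

        next-edge : ∀ i → E i (next-vertex i) (lab i)
        next-edge i = subst (λ j → Edge i j (lab i)) (sym (proj₂ (pre (π i)))) (edges i) , labels-on-arcs lab σ mono resp i

        starts-forward : isIn (dec (σ (enc (out zero)))) ≡ 1
        starts-forward = go ys len visits
          where
          go : ∀ ys → length ys ≡ N → Visits σ zero ys → isIn (dec (σ (enc (out zero)))) ≡ 1
          go (x ∷ _) _ (e , _) = trans (cong (isIn ∘ dec) e) (cong isIn (dec-enc (u x)))

        star-sum : sum (star ∘ lab) ≡ 1
        star-sum = let _ , rows , cols = cycle-balanced σ cyc resp in
          trans (sum-labels star refl lab σ mono) (trans (cols zero)
            (trans (sym (rows zero)) (trans (sum-rowW σ zero) starts-forward)))

        star-≤1 : ∀ i → star (lab i) ≤ 1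
        star-≤1 i = ≤-trans (≤-sum (star ∘ lab) i) (≤-reflexive star-sum)

        star-unique : ∀ {i u₀} → star (lab u₀) ≡ 1 → i ≢ u₀ → star (lab i) ≡ 0
        star-unique {i} star-root i≢ = n≤0⇒n≡0 (+-cancelˡ-≤ 1 _ _ (subst (_≤ 1) (cong (_+ star (lab i)) star-root)
          (≤-trans (+-≤-sum (star ∘ lab) (i≢ ∘ sym)) (≤-reflexive star-sum))))

        Inner : Lab → Set
        Inner c = star c ≡ 0 × ∃ λ i → c ≡ lab i

        module _ {u₀ u₁ : Fin m} (e : E u₀ u₁ (lab u₀)) (star-root : star (lab u₀) ≡ 1)
          (w : Walk u₁ u₀) (inner : AllSteps Inner w) where

          loop : Walk u₀ u₀
          loop = step (lab u₀) e w

          star-loop : weight star loop ≡ 1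
          star-loop = cong₂ _+_ star-root (weight-zero (AllSteps-map proj₁ inner))

          -- The relative permutation may have other cycles, but the one through the star carries
          -- every jump: star weight 1 forces each of its column sums to be 1.
          stop-loop : weight stop loop ≡ N
          stop-loop = trans (weight-sum (λ b → colW (suc b)) loop)
            (trans (sum-cong-≗ λ b → trans (closed-col (suc b) loop) star-loop) (ones N))
            where
            ones : ∀ k → sum {k} (λ _ → 1) ≡ k
            ones zero    = refl
            ones (suc k) = cong suc (ones k)

          stop-inner : h ≤ weight stop w
          -- The root step accounts for at most one of the `N` jumps into gadgets, which leaves at
          -- least `h′ + h`.
          stop-inner = ≤-trans (m≤n+m h h′) (+-cancelˡ-≤ 1 _ _
            (≤-trans (≤-reflexive (sym stop-loop)) (+-monoˡ-≤ (weight stop w) (stop≤1 (lab u₀)))))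

          all-stop≤1 : ∀ {x y} (w : Walk x y) → AllSteps (λ c → stop c ≤ 1) w
          all-stop≤1 nil          = nil
          all-stop≤1 (step c _ w) = step (stop≤1 c) (all-stop≤1 w)

          star-p : ∀ {v₀} (p : Walk u₁ v₀) (q : Walk v₀ u₀) → w ≡ p ⁀ q → weight star q ≡ 0 →
            star (lab u₀) + weight star p ≡ 1
          star-p p q refl star-q = trans (sym (+-identityʳ _)) (trans (cong (star (lab u₀) + weight star p +_) (sym star-q))
            (trans (+-assoc (star (lab u₀)) _ _) (trans (cong (star (lab u₀) +_) (sym (weight-⁀ star p q))) star-loop)))

          linked-q : ∀ {v₀} {q : Walk v₀ u₀} → AllSteps Inner q →
            Along (λ a x → weight (rowW a) q ≡ weight (colW (suc x)) q) suc zero ys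
          linked-q inner = along-map
            (λ σa → weight-cong (AllSteps-map (λ { (_ , i , refl) → row≡col lab σ mono (proj₁ cyc) σa i }) inner)) zero ys visits

          split-loop : Split ys
          split-loop =
            let v₀ , p , q , inner-q , eq , stop-q = split-suffix stop h w inner (all-stop≤1 w) stop-inner
                star-q = weight-zero (AllSteps-map proj₁ inner-q)
            in split u₀ v₀ (step (lab u₀) e p) q (star-p p q eq star-q) star-q stop-q (linked-q inner-q)

        split-at : ∀ u₀ → star (lab u₀) ≡ 1 → (∃ λ k → iter next-vertex k (next-vertex u₀) ≡ u₀) → Split ys
        split-at u₀ star-root (k , eq) = from (orbit-walk next-vertex lab next-edge u₀ inner k (next-vertex u₀) eq)
          where
          inner : ∀ i → i ≢ u₀ → Inner (lab i)
          inner i i≢ = star-unique star-root i≢ , i , refl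
          from : (∃ λ (w : Walk (next-vertex u₀) u₀) → AllSteps Inner w) → Split ys
          from (w , inner-w) = split-loop (next-edge u₀) star-root w inner-w

        split-orbit : Split ys
        split-orbit = from (sum-positive (star ∘ lab) (subst (0 <_) (sym star-sum) (s≤s z≤n)))
          where
          from : (∃ λ i → 0 < star (lab i)) → Split ys
          from (u₀ , 0<star) = split-at u₀ (≤-antisym (star-≤1 u₀) 0<star) (returns next-vertex next-injective u₀)

      -- Counting the pairs of end points.

      ys₀ : List (List (Fin N))
      ys₀ = orderings (Vec.allFin N)

      splits : ¬ ¬ All Split ys₀
      splits = ¬¬-All ys₀ λ {ys} ys∈ K →
        let len , mem = orderings-sound (Vec.allFin N) ys∈
            σ , cyc , resp , visits = fwd-tour ys len (λ i → mem (∈-allFin⁺ i))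
        in matching-of σ cyc λ (π , lab , π-inj , edges , mono) →
          K (split-orbit σ cyc resp ys len visits π lab π-inj edges mono)

      attach : ∀ {xs} → All Split xs → List (∃ Split)
      attach []       = []
      attach (d ∷ ds) = (_ , d) ∷ attach ds

      attach-map : ∀ {xs} (ds : All Split xs) → map proj₁ (attach ds) ≡ xs
      attach-map []       = refl
      attach-map (d ∷ ds) = cong (_ ∷_) (attach-map ds)

      key : ∃ Split → Fin (m * m)
      key (_ , d) = combine (start d) (middle d)

      -- A nonempty fibre supplies the representative whose sets bound the whole fibre.
      fibre-≤ : (ds : All Split ys₀) → ∀ k → count (λ x → key x == k) (attach ds) ≤ h ! * h !
      fibre-≤ ds k = cases (count-witness (λ x → key x == k) (attach ds))
        where
        open ≤-Reasoning hiding (start)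
        fits : ∀ {ys} (d : Split ys) → T (key (ys , d) == k) → ∀ {x} → T (key x == k) → T (compatible d (proj₁ x))
        fits d hit {zs , d′} t′ =
          let eq , eq′ = combine-injective (start d) (middle d) (start d′) (middle d′) (trans (==-true hit) (sym (==-true t′)))
          in class-compatible d d′ eq eq′
        cases : count (λ x → key x == k) (attach ds) ≡ 0 ⊎ (∃ λ x → x ∈ attach ds × T (key x == k)) →
          count (λ x → key x == k) (attach ds) ≤ h ! * h !
        cases (inj₁ none) = ≤-trans (≤-reflexive none) z≤n
        cases (inj₂ ((ys , d) , _ , hit)) = begin
          count (λ x → key x == k) (attach ds)                     ≤⟨ count-mono _ (compatible d ∘ proj₁) (attach ds) (λ {x} _ → fits d hit {x}) ⟩
          count (compatible d ∘ proj₁) (attach ds)                 ≡⟨ count-map (compatible d) proj₁ (attach ds) ⟨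
          count (compatible d) (map proj₁ (attach ds))             ≡⟨ cong (count (compatible d)) (attach-map ds) ⟩
          count (compatible d) ys₀                                 ≤⟨ count-consistent _ (Jb d) (Ib d zero) (Vec.allFin N) ⟩
          vcount (Jb d) (Vec.allFin N) ! * vcount (not ∘ Jb d) (Vec.allFin N) !
            ≡⟨ cong₂ (λ a b → a ! * b !) (vcount-Jb d) (vcount-notJb d) ⟩
          h ! * h !                                                ∎

      class-count : 2 ^ h ≤ m * m
      class-count = decidable-stable (2 ^ h ≤? m * m) λ K → splits λ ds → K (cancel (bound ds))
        where
        open ≤-Reasoning hiding (start)
        bound : All Split ys₀ → N ! ≤ m * m * (h ! * h !)
        bound ds = begin
          N !                    ≡⟨ length-orderings (Vec.allFin N) ⟨
          length ys₀             ≡⟨ cong length (attach-map ds) ⟨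
          length (map proj₁ (attach ds)) ≡⟨ length-map proj₁ (attach ds) ⟩
          length (attach ds)     ≤⟨ fibres-bound key (h ! * h !) (attach ds) (fibre-≤ ds) ⟩
          m * m * (h ! * h !)    ∎
        cancel : N ! ≤ m * m * (h ! * h !) → 2 ^ h ≤ m * m
        cancel le = *-cancelʳ-≤ (2 ^ h) (m * m) (h ! * h !) {{h !* h !≢0}}
          (≤-trans (central-factorial h) le)

    lower-bound : 2 ^ h ≤ m * m
    lower-bound = decidable-stable (2 ^ h ≤? m * m) λ K →
      let σ , cyc , resp , σ-first = bwd-tour in
      matching-of σ cyc λ (π₀ , lab₀ , π₀-inj , edge₀ , mono) →
        let ε , rows , cols = cycle-balanced σ cyc resp
            ε≡0 = trans (sym (rows zero)) (trans (sum-rowW σ zero)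
                    (trans (cong (isIn ∘ dec) σ-first) (cong isIn (dec-enc (t zero)))))
            -- There is at least one pad, so a vertex `zero` exists. Its variable labels some
            -- supported edge, and any such edge yields 0 ≤ 1.
            i , _ = label-of lab₀ σ mono zero
            vanish : ∀ (w : Lab → ℕ) → w nothing ≡ 0 → sum (λ k → w (just (k , σ k))) ≡ ε → ∀ i → w (lab₀ i) ≡ 0
            vanish w w₀ s i = n≤0⇒n≡0 (≤-trans (≤-sum (w ∘ lab₀) i)
              (≤-reflexive (trans (sum-labels w w₀ lab₀ σ mono) (trans s ε≡0))))
        in K (Relative.class-count (supported⇒0≤1 i (π₀ i) (lab₀ i) (edge₀ i)) π₀ lab₀ π₀-inj edge₀
                (labels-on-arcs lab₀ σ mono resp) (λ a → vanish (rowW a) refl (rows a)) (λ b → vanish (colW b) refl (cols b)))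

-- The exponential bound

-- Each unit of `suc h` uses 6 vertices, two gadgets of three. One pad is always present, and the
-- remainder modulo 6 becomes further pads.
gadget-count : ∀ n → 7 ≤ n → ∃ λ r → ∃ λ h → r < 6 × n ≡ suc r + suc (h + suc h) * 3
gadget-count (suc k) (s≤s 6≤k) with k / 6 in eq
... | zero  = contradiction 6≤k (<⇒≱ (subst (_< 6)
                (sym (trans (m≡m%n+[m/n]*n k 6) (trans (cong (λ j → k % 6 + j * 6) eq) (+-identityʳ _)))) (m%n<n k 6)))
... | suc h = k % 6 , h , m%n<n k 6 ,
              cong suc (trans (m≡m%n+[m/n]*n k 6) (cong (k % 6 +_) (trans (cong (_* 6) eq) (lemma h))))
  where
  lemma : ∀ h → suc h * 6 ≡ suc (h + suc h) * 3
  lemma = solve-∀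

power-bound : ∀ {n m h} k → n ≤ h * k → 2 ^ h ≤ m * m → 2 ^ n ≤ m ^ (2 * k)
power-bound {n} {m} {h} k n≤ 2^h≤ = begin
  2 ^ n          ≤⟨ ^-monoʳ-≤ 2 n≤ ⟩
  2 ^ (h * k)    ≡⟨ ^-*-assoc 2 h k ⟨
  (2 ^ h) ^ k    ≤⟨ ^-monoˡ-≤ k 2^h≤ ⟩
  (m * m) ^ k    ≡⟨ cong (λ x → (m * x) ^ k) (*-identityʳ m) ⟨
  (m ^ 2) ^ k    ≡⟨ ^-*-assoc m 2 k ⟩
  m ^ (2 * k)    ∎
  where open ≤-Reasoning

module _ {c ℓ₁ ℓ₂} (R : TotallyOrderedSemiring c ℓ₁ ℓ₂) where

  open Polynomials R using (IsMonotoneAffineProjection; HC; perm)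

  exponential-bound : ∀ n m → 7 ≤ n → IsMonotoneAffineProjection (HC n) (perm m) → 2 ^ n ≤ m ^ 24
  exponential-bound n m 7≤n proj with gadget-count n 7≤n
  -- At most 6 pads next to 6 `suc h` gadget vertices give n ≤ 12 `suc h`. The square in `m * m`
  -- doubles the exponent 12 to 24.
  ... | r , h , r<6 , refl = power-bound {m = m} {h = suc h} 12 size (LowerBound.lower-bound R r h m proj)
    where
    lemma : ∀ h → 6 + suc (h + suc h) * 3 + h * 6 ≡ suc h * 12
    lemma = solve-∀
    size : suc r + suc (h + suc h) * 3 ≤ suc h * 12
    size = ≤-trans (+-monoˡ-≤ _ r<6) (≤-trans (m≤m+n _ (h * 6)) (≤-reflexive (lemma h)))

-- Exponential against polynomial growth.

n<2^n : ∀ n → n < 2 ^ n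
n<2^n zero    = s≤s z≤n
n<2^n (suc n) = begin-strict
  suc n             ≤⟨ n<2^n n ⟩
  2 ^ n             <⟨ m<m+n (2 ^ n) (m^n>0 2 n) ⟩
  2 ^ n + 2 ^ n     ≡⟨ cong (2 ^ n +_) (+-identityʳ (2 ^ n)) ⟨
  2 * 2 ^ n         ∎
  where open ≤-Reasoning

polynomial-at-2^t : ∀ C d t → C * (2 ^ t) ^ d + C ≤ 2 ^ (suc C + t * d)
polynomial-at-2^t C d t = begin
  C * (2 ^ t) ^ d + C                 ≡⟨ cong (λ k → C * k + C) (^-*-assoc 2 t d) ⟩
  C * P + C                           ≤⟨ +-mono-≤ (*-monoˡ-≤ P C≤) (≤-trans C≤ (m≤m*n (2 ^ C) P {{m^n≢0 2 (t * d)}})) ⟩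
  2 ^ C * P + 2 ^ C * P               ≡⟨ cong₂ (λ x y → x + y) (^-distribˡ-+-* 2 C (t * d)) (^-distribˡ-+-* 2 C (t * d)) ⟨
  2 ^ (C + t * d) + 2 ^ (C + t * d)   ≡⟨ cong (2 ^ (C + t * d) +_) (+-identityʳ _) ⟨
  2 * 2 ^ (C + t * d)                 ∎
  where
  open ≤-Reasoning
  P = 2 ^ (t * d)
  C≤ : C ≤ 2 ^ C
  C≤ = <⇒≤ (n<2^n C)

-- The exponent is doubled because two copies of s < 2^s multiply to s s < 2^(s+s), while the left
-- side is at most s s.
exponential-beats-linear : ∀ a b s → a + 2 * b ≤ s → a + (s + s) * b < 2 ^ (s + s)
exponential-beats-linear a b zero    le with m+n≤o⇒m≤o a le | m+n≤o⇒n≤o a le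
... | z≤n | _ = s≤s z≤n
exponential-beats-linear a b s@(suc _) le = begin-strict
  a + (s + s) * b       ≤⟨ +-monoˡ-≤ _ (m≤n*m a s) ⟩
  s * a + (s + s) * b   ≡⟨ lemma s a b ⟩
  s * (a + 2 * b)       ≤⟨ *-monoʳ-≤ s le ⟩
  s * s                 <⟨ *-mono-< (n<2^n s) (n<2^n s) ⟩
  2 ^ s * 2 ^ s         ≡⟨ ^-distribˡ-+-* 2 s s ⟨
  2 ^ (s + s)           ∎
  where
  open ≤-Reasoning
  lemma : ∀ s a b → s * a + (s + s) * b ≡ s * (a + 2 * b)
  lemma = solve-∀

exponential-beats-polynomial : ∀ k N₀ {p} → PolynomiallyBounded p → ¬ (∀ n → N₀ ≤ n → 2 ^ n ≤ p n ^ k)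
exponential-beats-polynomial k N₀ {p} (C , d , p≤) exp≤ = <⇒≱ beats (2^-cancel-≤ (begin
  2 ^ n                            ≤⟨ exp≤ n N₀≤n ⟩
  p n ^ k                          ≤⟨ ^-monoˡ-≤ k (≤-trans (p≤ n) (polynomial-at-2^t C d (s + s))) ⟩
  (2 ^ (suc C + (s + s) * d)) ^ k  ≡⟨ ^-*-assoc 2 (suc C + (s + s) * d) k ⟩
  2 ^ ((suc C + (s + s) * d) * k)  ≡⟨ cong (2 ^_) (lemma C d s k) ⟩
  2 ^ (a + (s + s) * b)            ∎))
  where
  open ≤-Reasoning
  a = suc C * k
  b = d * k
  -- Taking n itself as a power of two turns the polynomial bound into a power of two, so only
  -- exponents are compared. The summand `N₀` makes n large enough for the hypothesis.
  s = a + 2 * b + N₀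
  n = 2 ^ (s + s)
  lemma : ∀ C d s k → (suc C + (s + s) * d) * k ≡ suc C * k + (s + s) * (d * k)
  lemma = solve-∀
  beats : a + (s + s) * b < n
  beats = exponential-beats-linear a b s (m≤m+n (a + 2 * b) N₀)
  N₀≤n : N₀ ≤ n
  N₀≤n = ≤-trans (m≤n+m N₀ (a + 2 * b)) (≤-trans (m≤m+n s s) (<⇒≤ (n<2^n (s + s))))
  2^-cancel-≤ : ∀ {x y} → 2 ^ x ≤ 2 ^ y → x ≤ y
  2^-cancel-≤ le = ≮⇒≥ λ y<x → <⇒≱ (^-monoʳ-< 2 (s≤s (s≤s z≤n)) y<x) le

not-p-projection : ∀ {c ℓ₁ ℓ₂} (R : TotallyOrderedSemiring c ℓ₁ ℓ₂) → ¬ HCIsPProjectionOfPerm R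
not-p-projection R (p , bounded , N₀ , projection) = exponential-beats-polynomial 24 (N₀ + 7) bounded λ n N₀+7≤n →
  exponential-bound R n (p n) (≤-trans (m≤n+m 7 N₀) N₀+7≤n) (projection n (≤-trans (m≤m+n N₀ 7) N₀+7≤n))

theorem4p2 : ∀ {c ℓ₁ ℓ₂ : Level} →
    (∃ λ p → ∃ λ q → ∃ λ N → 0 < p × 0 < q ×
    ((R : TotallyOrderedSemiring c ℓ₁ ℓ₂) → (n m : ℕ) → N ≤ n →
    Polynomials.IsMonotoneAffineProjection R (Polynomials.HC R n) (Polynomials.perm R m) →
    2 ^ (p * n) ≤ m ^ q))
    × ((R : TotallyOrderedSemiring c ℓ₁ ℓ₂) → ¬ HCIsPProjectionOfPerm R)
theorem4p2 =
  -- The constant epsilon is the fraction 1/24; from 7 on, n has room for a pad and two gadgets.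
  (1 , 24 , 7 , s≤s z≤n , s≤s z≤n , λ R n m 7≤n proj →
    subst (λ k → 2 ^ k ≤ m ^ 24) (sym (*-identityˡ n)) (exponential-bound R n m 7≤n proj)) ,
  not-p-projection
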